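{- Let $n\ge 2$ be an integer and let $\mathcal F$ be a family of subsets of $[m]=\{1,\dots,m\}$ with $\mathrm{cd}^n(\mathcal F)\ge 2n-1$. Then for every map $c\colon\mathcal F\to\mathbb{Z}/n$ there exist pairwise disjoint $A_1,\dots,A_n\in\mathcal F$ with $\sum_{i=1}^n c(A_i)=0$ in $\mathbb{Z}/n$ (i.e., every $\mathbb{Z}/n$-coloring of $\mathrm{KG}^n(\mathcal F)$ has a zero-sum hyperedge).
   Context: The $n$-uniform Kneser hypergraph $\mathrm{KG}^n(\mathcal F)$ has vertex set $\mathcal F$, and $A_1,\dots,A_n\in\mathcal F$ form a hyperedge if they are pairwise disjoint. The $n$-colorability defect is $\mathrm{cd}^n(\mathcal F)=m-\max\{\sum_{i=1}^n|A_i| : A_1,\dots,A_n\subseteq[m] \text{ pairwise disjoint, and } F\not\subseteq A_i \text{ for all } F\in\mathcal F,\ i\in[n]\}$. A $\mathbb{Z}/n$-coloring is a map from the vertex set to $\mathbb{Z}/n$; a hyperedge is zero-sum if the colors of its vertices sum to $0$. -}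

module Defs where

open import Data.Nat using (ℕ; _+_; _∸_; _*_; _≤_; _%_)
open import Data.Bool using (Bool; T)
open import Data.Fin using (Fin; toℕ)
open import Data.Fin.Subset using (Subset; _∩_; _⊆_; Empty; ∣_∣)
open import Data.List using (map; allFin)
open import Data.Nat.ListAction using (sum)
open import Relation.Binary.PropositionalEquality using (_≡_; _≢_)
open import Relation.Nullary using (¬_)
open import Data.Nat.Divisibility using (_∣_)

Family : ℕ → Set
Family m = Subset m → Bool

Σ[_]_ : (n : ℕ) → (Fin n → ℕ) → ℕ
Σ[ n ] f = sum (map f (allFin n))

PairwiseDisjoint : {m n : ℕ} → (Fin n → Subset m) → Set
PairwiseDisjoint {m} {n} A = (i j : Fin n) → i ≢ j → Empty (A i ∩ A j)

Admissible : {m : ℕ} (n : ℕ) → Family m → (Fin n → Subset m) → Set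
Admissible {m} n F B =
  PairwiseDisjoint B × ((i : Fin n) (S : Subset m) → T (F S) → ¬ (S ⊆ B i))
  where open import Data.Product using (_×_)

-- cd^n(F) ≥ k, i.e.  m - max { Σ |B_i| : B admissible } ≥ k,
-- i.e. every admissible tuple satisfies Σ |B_i| + k ≤ m.
cd≥ : {m : ℕ} (n : ℕ) → Family m → ℕ → Set
cd≥ {m} n F k = (B : Fin n → Subset m) → Admissible n F B → Σ[ n ] (λ i → ∣ B i ∣) + k ≤ m

-- A Z/n-coloring of the vertex set F of KG^n(F); Z/n is represented by Fin n.
Coloring : {m : ℕ} (n : ℕ) → Family m → Set
Coloring {m} n F = (S : Subset m) → T (F S) → Fin n

ZeroSum : (n : ℕ) → (Fin n → Fin n) → Set
ZeroSum n x = n ∣ Σ[ n ] (λ i → toℕ (x i))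

{-# OPTIONS --safe #-}

-- For composite n = b a, call N ⊆ [m] good if F restricted to N has a hyperedge of size a whose
-- colours sum to 0 mod a.  The good sets satisfy the hypothesis for b, and b disjoint good sets, coloured
-- by (sum of colours) / a, yield the hyperedge: this is the induction step of Erdős–Ginzburg–Ziv.
--
-- For n = p prime the proof is topological.  A nonzero vector x over ℤ/p ∪ {0} encodes disjoint sets
-- B_0, …, B_{p-1}, permuted cyclically by ℤ/p.  Suppose no hyperedge is zero-sum and let S_i be the set of
-- colours of members of F inside B_i.  Record x by its size while all S_i are empty, then by
-- {i : S_i ≠ ∅}, and, once all S_i are nonempty, by {i : |S_i| ≥ 2} (or by the colours themselves
-- if there is no such i).  By Cauchy–Davenport for two-element sets |S_i| ≥ 2 for at most p - 2 indices,
-- so this takes place in at most m - 1 levels.  On every level a barycentre in ℤ/p provides an equivariant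
-- sign that depends only on the record, so the sign is constant along chains that stay on one level.
-- This contradicts a Tucker lemma: for every equivariant sign there is a chain of m vectors whose
-- consecutive signs differ.
--
-- The Tucker lemma is proved by pulling back along the sign the standard cocycle that generates the
-- cohomology of ℤ/p in degree m - 1 and evaluating it on an explicit chain.  The value is 1 modulo p,
-- whereas the cocycle vanishes on simplices with two equal consecutive signs.
module Submission where

open import Defs
open import Data.Nat using (ℕ; _≤_; _∸_; _*_)
open import Data.Fin using (Fin)
open import Data.Fin.Subset using (Subset)
open import Data.Bool using (T)
open import Data.Product using (Σ; _×_; _,_)

open import Data.Bool using (Bool; true; false; if_then_else_; _∧_)
open import Data.Bool.Properties using (T?; T-irrelevant)
open import Data.Empty using (⊥)
open import Data.Fin using (zero; suc; toℕ; fromℕ; fromℕ<; inject₁; combine; remQuot; _↑ˡ_; _↑ʳ_)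
open import Data.Fin.Properties
  using (toℕ-fromℕ<; toℕ-injective; toℕ<n; toℕ-fromℕ; toℕ-inject₁; any?; all?; pigeonhole; injective⇒≤; remQuot-combine; combine-remQuot)
  renaming (_≟_ to _≟ᶠ_; suc-injective to sucᶠ-injective)
open import Data.Fin.Subset using (_∩_; _⊆_; Empty; Nonempty; ∣_∣; _∈_) renaming (⊥ to ∅)
open import Data.Fin.Subset.Properties
  using (anySubset?; _⊆?_; nonempty?; x∈p∩q⁻; x∈p∩q⁺; drop-∷-⊆; ⊆-antisym; ⊆-refl; ⊥⊆; ∉⊥)
import Data.Integer as ℤ
import Data.Integer.Properties as ℤₚ
import Data.Integer.Tactic.RingSolver as ℤ-Solver
open import Data.List using (List; []; _∷_; length) renaming (map to mapL)
import Data.List.Properties as Listₚ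
open import Data.Maybe using (Maybe; just; nothing) renaming (map to mapM)
open import Data.Maybe.Properties using (just-injective)
open import Data.Nat hiding (ℕ; _≤_; _∸_; _*_; _≟_; compare; ∣_-_∣)
import Data.Nat.Coprimality as Coprimality
open import Data.Nat.Divisibility using (_∣_; _∣?_; divides; m%n≡0⇒n∣m; n∣m⇒m%n≡0; ∣⇒≤; m∣m*n; *-monoʳ-∣; hasNonTrivialDivisor)
open import Data.Nat.DivMod
open import Data.Nat.GCD using (module Bézout)
open import Data.Nat.Induction using (<-rec)
import Data.Nat.ListAction as ListAction
open import Data.Nat.Primality using (Prime; prime?; ¬prime⇒composite)
open import Data.Nat.Properties hiding (_≟_; _≤?_; _<?_)
open import Data.Nat.Tactic.RingSolver using (solve-∀)
open import Algebra.Properties.Semiring.Sum +-*-semiring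
  using (sum-cong-≗; ∑-distrib-+; sum-init-last; *-distribˡ-sum) renaming (sum to ∑)
open import Data.Product using (∃; proj₁; proj₂)
open import Data.Sum using (_⊎_; inj₁; inj₂)
open import Data.Unit using (⊤; tt)
open import Data.Vec using (Vec; []; _∷_; replicate; lookup; here; there) renaming (map to mapV)
open import Data.Vec.Functional using () renaming ([] to empty; _∷_ to infixr 5 _◂_)
import Data.Vec.Properties as Vecₚ
open import Function using (_∘_; id)
open import Relation.Binary.PropositionalEquality
open import Relation.Nullary using (Dec; yes; no; ¬_; ¬?; isYes)
open import Relation.Nullary.Decidable using (decidable-stable; map′; _×-dec_; _→-dec_; toWitness; fromWitness)
open import Relation.Nullary.Negation using (contradiction)

-- Equivariant cochains of a cyclic group and the Tucker lemma.

module EquivariantCochains where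
  open ℤ using (ℤ; +_; 0ℤ; 1ℤ; -1ℤ) renaming (∣_∣ to abs; -_ to ⊝_; _+_ to _⊕_; _-_ to _⊖_; _*_ to _⊛_)
  open ℤ-Solver using () renaming (solve-∀ to ring-∀)
  open ≡-Reasoning

  -- Cochains and chain homotopies

  Cochain : Set → Set
  Cochain A = List A → ℤ

  -- The augmented simplicial coboundary: lists of length k + 1 are k-simplices, and [] is the (-1)-simplex.
  δ : {A : Set} → Cochain A → Cochain A
  δ φ []       = 0ℤ
  δ φ (x ∷ xs) = φ xs ⊖ δ (λ ys → φ (x ∷ ys)) xs

  -- Stated with pointwise equations so that one property yields every rule of linearity: c = 0
  -- gives `linear-cong`, and c = -1 gives `linear-zero` and `linear-minus`.
  Linear : {X Y : Set} → ((X → ℤ) → Y → ℤ) → Set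
  Linear F = ∀ {φ ψ χ} c → (∀ x → χ x ≡ φ x ⊕ c ⊛ ψ x) → ∀ y → F χ y ≡ F φ y ⊕ c ⊛ F ψ y

  module _ {X Y : Set} {F : (X → ℤ) → Y → ℤ} (lin : Linear F) where

    linear-cong : ∀ {φ ψ} → (∀ x → φ x ≡ ψ x) → ∀ y → F φ y ≡ F ψ y
    linear-cong {φ} {ψ} eq y = trans (lin {ψ} {ψ} {φ} 0ℤ (λ x → trans (eq x) (lem (ψ x) (ψ x))) y) (sym (lem (F ψ y) (F ψ y)))
      where
      lem : ∀ a b → a ≡ a ⊕ 0ℤ ⊛ b
      lem = ring-∀

    linear-zero : ∀ {φ} → (∀ x → φ x ≡ 0ℤ) → ∀ y → F φ y ≡ 0ℤ
    linear-zero {φ} eq y = trans (lin {φ} {φ} {φ} -1ℤ (λ x → trans (eq x) (lem (φ x))) y) (sym (lem (F φ y)))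
      where
      lem : ∀ a → 0ℤ ≡ a ⊕ -1ℤ ⊛ a
      lem = ring-∀

    linear-minus : ∀ {φ ψ χ} → (∀ x → χ x ≡ φ x ⊖ ψ x) → ∀ y → F χ y ≡ F φ y ⊖ F ψ y
    linear-minus {φ} {ψ} eq y =
      trans (lin -1ℤ (λ x → trans (eq x) (lem (φ x) (ψ x))) y) (sym (lem (F φ y) (F ψ y)))
      where
      lem : ∀ a b → a ⊖ b ≡ a ⊕ -1ℤ ⊛ b
      lem = ring-∀

  δ-linear : {A : Set} → Linear (δ {A})
  δ-linear c eq []       = lem c
    where
    lem : ∀ c → 0ℤ ≡ 0ℤ ⊕ c ⊛ 0ℤ
    lem = ring-∀
  δ-linear {A} {φ} {ψ} {χ} c eq (x ∷ xs) =
    trans (cong₂ _⊖_ (eq xs) (δ-linear c (λ ys → eq (x ∷ ys)) xs))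
          (lem c (φ xs) (ψ xs) (δ (λ ys → φ (x ∷ ys)) xs) (δ (λ ys → ψ (x ∷ ys)) xs))
    where
    lem : ∀ c a b a′ b′ → (a ⊕ c ⊛ b) ⊖ (a′ ⊕ c ⊛ b′) ≡ (a ⊖ a′) ⊕ c ⊛ (b ⊖ b′)
    lem = ring-∀

  δ-natural : {A B : Set} (f : A → B) (φ : Cochain B) → ∀ l → δ (φ ∘ mapL f) l ≡ δ φ (mapL f l)
  δ-natural f φ []       = refl
  δ-natural f φ (x ∷ xs) = cong (φ (mapL f xs) ⊖_) (δ-natural f (λ ys → φ (f x ∷ ys)) xs)

  δδ≡0 : {A : Set} (φ : Cochain A) → ∀ l → δ (δ φ) l ≡ 0ℤ
  δδ≡0 φ []       = refl
  δδ≡0 φ (x ∷ xs) = begin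
    δ φ xs ⊖ δ (λ ys → φ ys ⊖ δ φₓ ys) xs  ≡⟨ cong (δ φ xs ⊖_) (linear-minus δ-linear {φ} {δ φₓ} (λ _ → refl) xs) ⟩
    δ φ xs ⊖ (δ φ xs ⊖ δ (δ φₓ) xs)        ≡⟨ lem (δ φ xs) (δ (δ φₓ) xs) ⟩
    δ (δ φₓ) xs                            ≡⟨ δδ≡0 φₓ xs ⟩
    0ℤ                                     ∎
    where
    φₓ = λ ys → φ (x ∷ ys)
    lem : ∀ a b → a ⊖ (a ⊖ b) ≡ b
    lem = ring-∀

  module Homotopy {A B : Set} (ι V : A → B) (v : B) where

    -- The dual of the prism operator: the alternating sum of φ over the simplices
    -- `ι x₀, …, ι xᵢ, V xᵢ, …, V xₖ`.
    prism : Cochain B → Cochain A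
    prism φ []       = 0ℤ
    prism φ (x ∷ xs) = φ (ι x ∷ V x ∷ mapL V xs) ⊖ prism (λ ys → φ (ι x ∷ ys)) xs

    -- Moves a simplex from ι to V along the prism and then contracts its V-image to v.
    K : Cochain B → Cochain A
    K φ l = φ (v ∷ mapL V l) ⊖ prism φ l

    prism-linear : Linear prism
    prism-linear c eq []       = lem c
      where
      lem : ∀ c → 0ℤ ≡ 0ℤ ⊕ c ⊛ 0ℤ
      lem = ring-∀
    prism-linear {φ} {ψ} c eq (x ∷ xs) =
      trans (cong₂ _⊖_ (eq l) (prism-linear c (λ ys → eq (ι x ∷ ys)) xs))
            (lem c (φ l) (ψ l) (prism (λ ys → φ (ι x ∷ ys)) xs) (prism (λ ys → ψ (ι x ∷ ys)) xs))
      where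
      l = ι x ∷ V x ∷ mapL V xs
      lem : ∀ c a b a′ b′ → (a ⊕ c ⊛ b) ⊖ (a′ ⊕ c ⊛ b′) ≡ (a ⊖ a′) ⊕ c ⊛ (b ⊖ b′)
      lem = ring-∀

    K-linear : Linear K
    K-linear {φ} {ψ} c eq l =
      trans (cong₂ _⊖_ (eq l′) (prism-linear c eq l)) (lem c (φ l′) (ψ l′) (prism φ l) (prism ψ l))
      where
      l′ = v ∷ mapL V l
      lem : ∀ c a b a′ b′ → (a ⊕ c ⊛ b) ⊖ (a′ ⊕ c ⊛ b′) ≡ (a ⊖ a′) ⊕ c ⊛ (b ⊖ b′)
      lem = ring-∀

    prism-homotopy : ∀ φ l → prism (δ φ) l ⊕ δ (prism φ) l ≡ φ (mapL V l) ⊖ φ (mapL ι l)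
    prism-homotopy φ []       = sym (ℤₚ.+-inverseʳ (φ []))
    prism-homotopy φ (x ∷ xs) = begin
      (φ (V x ∷ vs) ⊖ (φ (ι x ∷ vs) ⊖ δ φₗᵥ vs) ⊖ prism (λ ys → φ ys ⊖ δ φₗ ys) xs)
        ⊕ (prism φ xs ⊖ δ (λ ys → φₗᵥ (mapL V ys) ⊖ prism φₗ ys) xs)
        ≡⟨ cong₂ (λ a b → (φ (V x ∷ vs) ⊖ (φ (ι x ∷ vs) ⊖ δ φₗᵥ vs) ⊖ a) ⊕ (prism φ xs ⊖ b))
             (linear-minus prism-linear {φ} {δ φₗ} (λ _ → refl) xs)
             (trans (linear-minus δ-linear {φₗᵥ ∘ mapL V} {prism φₗ} (λ _ → refl) xs)
                    (cong (_⊖ δ (prism φₗ) xs) (δ-natural V φₗᵥ xs))) ⟩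
      (φ (V x ∷ vs) ⊖ (φ (ι x ∷ vs) ⊖ δ φₗᵥ vs) ⊖ (prism φ xs ⊖ prism (δ φₗ) xs))
        ⊕ (prism φ xs ⊖ (δ φₗᵥ vs ⊖ δ (prism φₗ) xs))
        ≡⟨ lem₁ (φ (V x ∷ vs)) (φ (ι x ∷ vs)) (δ φₗᵥ vs) (prism φ xs) (prism (δ φₗ) xs) (δ (prism φₗ) xs) ⟩
      (φ (V x ∷ vs) ⊖ φ (ι x ∷ vs)) ⊕ (prism (δ φₗ) xs ⊕ δ (prism φₗ) xs)
        ≡⟨ cong ((φ (V x ∷ vs) ⊖ φ (ι x ∷ vs)) ⊕_) (prism-homotopy φₗ xs) ⟩
      (φ (V x ∷ vs) ⊖ φ (ι x ∷ vs)) ⊕ (φ (ι x ∷ vs) ⊖ φ (ι x ∷ mapL ι xs))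
        ≡⟨ lem₂ (φ (V x ∷ vs)) (φ (ι x ∷ vs)) (φ (ι x ∷ mapL ι xs)) ⟩
      φ (V x ∷ vs) ⊖ φ (ι x ∷ mapL ι xs) ∎
      where
      vs  = mapL V xs
      φₗ  = λ ys → φ (ι x ∷ ys)
      φₗᵥ = λ ys → φ (ι x ∷ V x ∷ ys)
      lem₁ : ∀ a b c d e f → (a ⊖ (b ⊖ c) ⊖ (d ⊖ e)) ⊕ (d ⊖ (c ⊖ f)) ≡ (a ⊖ b) ⊕ (e ⊕ f)
      lem₁ = ring-∀
      lem₂ : ∀ a b c → (a ⊖ b) ⊕ (b ⊖ c) ≡ a ⊖ c
      lem₂ = ring-∀

    -- The cone from `v` over the V-image cancels the V-end of the prism, so that K is a
    -- null-homotopy of the pullback along ι.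
    homotopy : ∀ φ l → K (δ φ) l ≡ φ (mapL ι l) ⊖ δ (K φ) l
    homotopy φ l = begin
      φ (mapL V l) ⊖ δ φᵥ (mapL V l) ⊖ prism (δ φ) l
        ≡⟨ lem (φ (mapL V l)) (δ φᵥ (mapL V l)) (prism (δ φ) l) (φ (mapL ι l)) (δ (prism φ) l) (prism-homotopy φ l) ⟩
      φ (mapL ι l) ⊖ (δ φᵥ (mapL V l) ⊖ δ (prism φ) l)
        ≡⟨ cong (φ (mapL ι l) ⊖_) (sym (trans (linear-minus δ-linear {φᵥ ∘ mapL V} {prism φ} (λ _ → refl) l)
                                              (cong (_⊖ δ (prism φ) l) (δ-natural V φᵥ l)))) ⟩
      φ (mapL ι l) ⊖ δ (K φ) l ∎
      where
      φᵥ = λ ys → φ (v ∷ ys)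
      lem : ∀ a b c d e → c ⊕ e ≡ a ⊖ d → a ⊖ b ⊖ c ≡ d ⊖ (b ⊖ e)
      lem a b c d e eq = begin
        a ⊖ b ⊖ c                     ≡⟨ lem′ a b c d e ⟩
        (a ⊖ d) ⊖ (c ⊕ e) ⊕ (d ⊖ (b ⊖ e)) ≡⟨ cong (λ z → (a ⊖ d) ⊖ z ⊕ (d ⊖ (b ⊖ e))) eq ⟩
        (a ⊖ d) ⊖ (a ⊖ d) ⊕ (d ⊖ (b ⊖ e)) ≡⟨ lem″ (a ⊖ d) (d ⊖ (b ⊖ e)) ⟩
        d ⊖ (b ⊖ e) ∎
        where
        lem′ : ∀ a b c d e → a ⊖ b ⊖ c ≡ (a ⊖ d) ⊖ (c ⊕ e) ⊕ (d ⊖ (b ⊖ e))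
        lem′ = ring-∀
        lem″ : ∀ a b → a ⊖ a ⊕ b ≡ b
        lem″ = ring-∀

  -- Orbit sums

  iter : {X : Set} → (X → X) → ℕ → X → X
  iter τ zero    x = x
  iter τ (suc j) x = iter τ j (τ x)

  iter-suc : {X : Set} (τ : X → X) → ∀ j x → iter τ (suc j) x ≡ τ (iter τ j x)
  iter-suc τ zero    x = refl
  iter-suc τ (suc j) x = iter-suc τ j (τ x)

  iter-+ : {X : Set} (τ : X → X) → ∀ i j x → iter τ i (iter τ j x) ≡ iter τ (i + j) x
  iter-+ τ i zero    x = cong (λ k → iter τ k x) (sym (+-identityʳ i))
  iter-+ τ i (suc j) x = trans (iter-+ τ i j (τ x)) (cong (λ k → iter τ k x) (sym (+-suc i j)))

  iter-semiconj : {X Y : Set} {τ : X → X} {σ : Y → Y} (h : X → Y) → (∀ x → h (τ x) ≡ σ (h x)) →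
                  ∀ j x → h (iter τ j x) ≡ iter σ j (h x)
  iter-semiconj h eq zero    x = refl
  iter-semiconj {τ = τ} {σ} h eq (suc j) x = trans (iter-semiconj h eq j (τ x)) (cong (iter σ j) (eq x))

  orbitSum : {X : Set} → (X → X) → ℕ → (X → ℤ) → X → ℤ
  orbitSum τ zero    φ x = 0ℤ
  orbitSum τ (suc j) φ x = φ x ⊕ orbitSum τ j φ (τ x)

  diff : {X : Set} → (X → X) → (X → ℤ) → X → ℤ
  diff τ φ x = φ (τ x) ⊖ φ x

  orbitSum-linear : {X : Set} (τ : X → X) → ∀ j → Linear (orbitSum τ j)
  orbitSum-linear τ zero    c eq x = lem c
    where
    lem : ∀ c → 0ℤ ≡ 0ℤ ⊕ c ⊛ 0ℤ
    lem = ring-∀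
  orbitSum-linear τ (suc j) {φ} {ψ} c eq x =
    trans (cong₂ _⊕_ (eq x) (orbitSum-linear τ j c eq (τ x)))
          (lem c (φ x) (ψ x) (orbitSum τ j φ (τ x)) (orbitSum τ j ψ (τ x)))
    where
    lem : ∀ c a b a′ b′ → (a ⊕ c ⊛ b) ⊕ (a′ ⊕ c ⊛ b′) ≡ (a ⊕ a′) ⊕ c ⊛ (b ⊕ b′)
    lem = ring-∀

  diff-linear : {X : Set} (τ : X → X) → Linear (diff τ)
  diff-linear τ {φ} {ψ} c eq x =
    trans (cong₂ _⊖_ (eq (τ x)) (eq x)) (lem c (φ (τ x)) (ψ (τ x)) (φ x) (ψ x))
    where
    lem : ∀ c a b a′ b′ → (a ⊕ c ⊛ b) ⊖ (a′ ⊕ c ⊛ b′) ≡ (a ⊖ a′) ⊕ c ⊛ (b ⊖ b′)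
    lem = ring-∀

  orbitSum-semiconj : {X Y : Set} {τ : X → X} {σ : Y → Y} (h : X → Y) → (∀ x → h (τ x) ≡ σ (h x)) →
                      ∀ j φ x → orbitSum τ j (φ ∘ h) x ≡ orbitSum σ j φ (h x)
  orbitSum-semiconj h eq zero    φ x = refl
  orbitSum-semiconj {τ = τ} {σ} h eq (suc j) φ x =
    cong (φ (h x) ⊕_) (trans (orbitSum-semiconj h eq j φ (τ x)) (cong (orbitSum σ j φ) (eq x)))

  -- The sum telescopes. When τ has period j the two remaining terms agree, so that `diff` and the
  -- full orbit sum annihilate each other.
  orbitSum-diff : {X : Set} (τ : X → X) → ∀ j φ x → diff τ (orbitSum τ j φ) x ≡ φ (iter τ j x) ⊖ φ x
  orbitSum-diff τ zero    φ x = sym (ℤₚ.+-inverseʳ (φ x))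
  orbitSum-diff τ (suc j) φ x = begin
    (φ (τ x) ⊕ b) ⊖ (φ x ⊕ a)        ≡⟨ lem₁ (φ (τ x)) a b (φ x) ⟩
    (b ⊖ a) ⊕ (φ (τ x) ⊖ φ x)        ≡⟨ cong (_⊕ (φ (τ x) ⊖ φ x)) (orbitSum-diff τ j φ (τ x)) ⟩
    (φ (iter τ j (τ x)) ⊖ φ (τ x)) ⊕ (φ (τ x) ⊖ φ x) ≡⟨ lem₂ (φ (iter τ j (τ x))) (φ (τ x)) (φ x) ⟩
    φ (iter τ j (τ x)) ⊖ φ x         ∎
    where
    a = orbitSum τ j φ (τ x)
    b = orbitSum τ j φ (τ (τ x))
    lem₁ : ∀ c a b d → (c ⊕ b) ⊖ (d ⊕ a) ≡ (b ⊖ a) ⊕ (c ⊖ d)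
    lem₁ = ring-∀
    lem₂ : ∀ a b c → (a ⊖ b) ⊕ (b ⊖ c) ≡ a ⊖ c
    lem₂ = ring-∀

  module _ {X : Set} (τ : X → X) (p : ℕ) (τᵖ≗id : ∀ x → iter τ p x ≡ x) where

    diff-orbitSum≡0 : ∀ φ x → diff τ (orbitSum τ p φ) x ≡ 0ℤ
    diff-orbitSum≡0 φ x =
      trans (orbitSum-diff τ p φ x) (trans (cong (λ y → φ y ⊖ φ x) (τᵖ≗id x)) (ℤₚ.+-inverseʳ (φ x)))

    orbitSum-diff≡0 : ∀ φ x → orbitSum τ p (diff τ φ) x ≡ 0ℤ
    orbitSum-diff≡0 φ x = begin
      orbitSum τ p (diff τ φ) x                       ≡⟨ linear-minus (orbitSum-linear τ p) {φ ∘ τ} {φ} (λ _ → refl) x ⟩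
      orbitSum τ p (φ ∘ τ) x ⊖ orbitSum τ p φ x       ≡⟨ cong (_⊖ orbitSum τ p φ x) (orbitSum-semiconj τ (λ _ → refl) p φ x) ⟩
      diff τ (orbitSum τ p φ) x                       ≡⟨ diff-orbitSum≡0 φ x ⟩
      0ℤ                                              ∎

    -- The boundary maps of the periodic free resolution of ℤ over ℤ[ℤ/p].
    resolution : ℕ → (X → ℤ) → X → ℤ
    resolution zero          = diff τ
    resolution (suc zero)    = orbitSum τ p
    resolution (suc (suc k)) = resolution k

    resolution-linear : ∀ k → Linear (resolution k)
    resolution-linear zero          {φ} {ψ} = diff-linear τ {φ} {ψ}
    resolution-linear (suc zero)    {φ} {ψ} = orbitSum-linear τ p {φ} {ψ}
    resolution-linear (suc (suc k)) {φ} {ψ} = resolution-linear k {φ} {ψ}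

    resolution²≡0 : ∀ k φ x → resolution k (resolution (suc k) φ) x ≡ 0ℤ
    resolution²≡0 zero          = diff-orbitSum≡0
    resolution²≡0 (suc zero)    = orbitSum-diff≡0
    resolution²≡0 (suc (suc k)) = resolution²≡0 k

  resolution-semiconj : {X Y : Set} {τ : X → X} {σ : Y → Y} (p : ℕ) (τᵖ : ∀ x → iter τ p x ≡ x) (σᵖ : ∀ x → iter σ p x ≡ x)
                        (h : X → Y) → (∀ x → h (τ x) ≡ σ (h x)) →
                        ∀ k φ x → resolution τ p τᵖ k (φ ∘ h) x ≡ resolution σ p σᵖ k φ (h x)
  resolution-semiconj p _ _ h eq zero          φ x = cong (λ y → φ y ⊖ φ (h x)) (eq x)
  resolution-semiconj p _ _ h eq (suc zero)    φ x = orbitSum-semiconj h eq p φ x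
  resolution-semiconj p a b h eq (suc (suc k)) φ x = resolution-semiconj p a b h eq k φ x

  orbitSum-δ : {A : Set} (τ : A → A) → ∀ j φ l → orbitSum (mapL τ) j (δ φ) l ≡ δ (orbitSum (mapL τ) j φ) l
  orbitSum-δ τ zero    φ l = sym (linear-zero δ-linear (λ _ → refl) l)
  orbitSum-δ τ (suc j) φ l = begin
    δ φ l ⊕ orbitSum (mapL τ) j (δ φ) (mapL τ l)       ≡⟨ cong (δ φ l ⊕_) (orbitSum-δ τ j φ (mapL τ l)) ⟩
    δ φ l ⊕ δ (orbitSum (mapL τ) j φ) (mapL τ l)       ≡⟨ cong (δ φ l ⊕_) (sym (trans (ℤₚ.*-identityˡ _) (δ-natural τ (orbitSum (mapL τ) j φ) l))) ⟩
    δ φ l ⊕ 1ℤ ⊛ δ (orbitSum (mapL τ) j φ ∘ mapL τ) l  ≡⟨ sym (δ-linear 1ℤ (λ ys → cong (φ ys ⊕_) (sym (ℤₚ.*-identityˡ _))) l) ⟩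
    δ (orbitSum (mapL τ) (suc j) φ) l                  ∎

  resolution-δ : {A : Set} (τ : A → A) (p : ℕ) (τᵖ : ∀ l → iter (mapL τ) p l ≡ l) →
                 ∀ k φ l → resolution (mapL τ) p τᵖ k (δ φ) l ≡ δ (resolution (mapL τ) p τᵖ k φ) l
  resolution-δ τ p _ zero φ l = begin
    δ φ (mapL τ l) ⊖ δ φ l     ≡⟨ cong (_⊖ δ φ l) (sym (δ-natural τ φ l)) ⟩
    δ (φ ∘ mapL τ) l ⊖ δ φ l   ≡⟨ sym (linear-minus δ-linear (λ _ → refl) l) ⟩
    δ (diff (mapL τ) φ) l      ∎
  resolution-δ τ p _ (suc zero)    φ l = orbitSum-δ τ p φ l
  resolution-δ τ p e (suc (suc k)) φ l = resolution-δ τ p e k φ l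

  iter-mapL : {A : Set} (τ : A → A) (p : ℕ) → (∀ x → iter τ p x ≡ x) → ∀ l → iter (mapL τ) p l ≡ l
  iter-mapL τ p eq l = trans (lem p l) (trans (Listₚ.map-cong eq l) (Listₚ.map-id l))
    where
    lem : ∀ j l → iter (mapL τ) j l ≡ mapL (iter τ j) l
    lem zero    l = sym (Listₚ.map-id l)
    lem (suc j) l = trans (lem j (mapL τ l)) (sym (Listₚ.map-∘ l))

  -- The cyclic successor.

  module _ {q : ℕ} where

    next : Fin (suc q) → Fin (suc q)
    next x with toℕ x <? q
    ... | yes x<q = fromℕ< (s≤s x<q)
    ... | no  _   = zero

    toℕ-next-< : ∀ x → toℕ x < q → toℕ (next x) ≡ suc (toℕ x)
    toℕ-next-< x x<q with toℕ x <? q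
    ... | yes lt = toℕ-fromℕ< (s≤s lt)
    ... | no ¬lt = contradiction x<q ¬lt

    next-≡ : ∀ x → toℕ x ≡ q → next x ≡ zero
    next-≡ x x≡q with toℕ x <? q
    ... | yes lt = contradiction x≡q (<⇒≢ lt)
    ... | no _   = refl

    next-cases : ∀ a → (toℕ a < q × toℕ (next a) ≡ suc (toℕ a)) ⊎ (toℕ a ≡ q × toℕ (next a) ≡ 0)
    next-cases a = go (toℕ a <? q)
      where
      go : Dec (toℕ a < q) → (toℕ a < q × toℕ (next a) ≡ suc (toℕ a)) ⊎ (toℕ a ≡ q × toℕ (next a) ≡ 0)
      go (yes a<q) = inj₁ (a<q , toℕ-next-< a a<q)
      go (no  a≮q) = inj₂ (a≡q , cong toℕ (next-≡ a a≡q))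
        where a≡q = ≤-antisym (≤-pred (toℕ<n a)) (≮⇒≥ a≮q)

    toℕ-iter : ∀ j → j ≤ q → toℕ (iter next j zero) ≡ j
    toℕ-iter zero    _   = refl
    toℕ-iter (suc j) j<q = begin
      toℕ (iter next (suc j) zero)  ≡⟨ cong toℕ (iter-suc next j zero) ⟩
      toℕ (next (iter next j zero)) ≡⟨ toℕ-next-< _ (subst (_< q) (sym eq) j<q) ⟩
      suc (toℕ (iter next j zero))  ≡⟨ cong suc eq ⟩
      suc j                         ∎
      where eq = toℕ-iter j (<⇒≤ j<q)

    iter-toℕ : ∀ x → iter next (toℕ x) zero ≡ x
    iter-toℕ x = toℕ-injective (toℕ-iter (toℕ x) (≤-pred (toℕ<n x)))

    -- Every element is an iterate of `zero` and iterates commute, so it suffices to return from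
    -- `zero` to `zero`.
    iter-period : ∀ x → iter next (suc q) x ≡ x
    iter-period x = begin
      iter next (suc q) x                            ≡⟨ cong (iter next (suc q)) (sym (iter-toℕ x)) ⟩
      iter next (suc q) (iter next (toℕ x) zero)     ≡⟨ iter-+ next (suc q) (toℕ x) zero ⟩
      iter next (suc q + toℕ x) zero               ≡⟨ cong (λ k → iter next k zero) (+-comm (suc q) (toℕ x)) ⟩
      iter next (toℕ x + suc q) zero               ≡⟨ sym (iter-+ next (toℕ x) (suc q) zero) ⟩
      iter next (toℕ x) (iter next (suc q) zero)     ≡⟨ cong (iter next (toℕ x)) (trans (iter-suc next q zero) (next-≡ _ (toℕ-iter q ≤-refl))) ⟩
      iter next (toℕ x) zero                         ≡⟨ iter-toℕ x ⟩
      x                                              ∎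

  -- The Tucker lemma

  -- Nonzero vectors over G ∪ {0}, where nothing plays the role of 0.
  data Signed (G : Set) : ℕ → Set where
    here  : ∀ {m} → G → Vec (Maybe G) m → Signed G (suc m)
    there : ∀ {m} → Signed G m → Signed G (suc m)

  toVec : ∀ {G m} → Signed G m → Vec (Maybe G) m
  toVec (here g v) = just g ∷ v
  toVec (there x)  = nothing ∷ toVec x

  relabel : ∀ {G m} → (G → G) → Signed G m → Signed G m
  relabel f (here g v) = here (f g) (mapV (mapM f) v)
  relabel f (there x)  = there (relabel f x)

  toVec-relabel : ∀ {G m} (f : G → G) (x : Signed G m) → toVec (relabel f x) ≡ mapV (mapM f) (toVec x)
  toVec-relabel f (here g v) = refl
  toVec-relabel f (there x)  = cong (nothing ∷_) (toVec-relabel f x)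

  toVec-injective : ∀ {G m} (x y : Signed G m) → toVec x ≡ toVec y → x ≡ y
  toVec-injective (here g v) (here .g .v) refl = refl
  toVec-injective (there x)  (there y)    eq   = cong there (toVec-injective x y (Vecₚ.∷-injectiveʳ eq))

  iter-relabel : ∀ {G m} (f : G → G) (p : ℕ) → (∀ g → iter f p g ≡ g) → (x : Signed G m) → iter (relabel f) p x ≡ x
  iter-relabel f p eq x = toVec-injective _ _ (begin
    toVec (iter (relabel f) p x)          ≡⟨ iter-semiconj toVec (toVec-relabel f) p x ⟩
    iter (mapV (mapM f)) p (toVec x)      ≡⟨ lem p (toVec x) ⟩
    mapV (mapM (iter f p)) (toVec x)      ≡⟨ Vecₚ.map-cong (λ { nothing → refl ; (just g) → cong just (eq g) }) (toVec x) ⟩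
    mapV id (toVec x)                     ≡⟨ Vecₚ.map-id (toVec x) ⟩
    toVec x                               ∎)
    where
    lem : ∀ j {m} (v : Vec (Maybe _) m) → iter (mapV (mapM f)) j v ≡ mapV (mapM (iter f j)) v
    lem zero    v = sym (trans (Vecₚ.map-cong (λ { nothing → refl ; (just g) → refl }) v) (Vecₚ.map-id v))
    lem (suc j) v = trans (lem j (mapV (mapM f) v)) (trans (sym (Vecₚ.map-∘ _ _ v))
                      (Vecₚ.map-cong (λ { nothing → refl ; (just g) → refl }) v))

  -- A chain in every dimension and its boundary.

  module Cycle (q : ℕ) where

    private G = Fin (suc q)

    shift : ∀ {m} → List (Signed G m) → List (Signed G m)
    shift = mapL (relabel next)

    shift-period : ∀ {m} (l : List (Signed G m)) → iter shift (suc q) l ≡ l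
    shift-period = iter-mapL (relabel next) (suc q) (iter-relabel next (suc q) iter-period)

    D : ∀ {m} → ℕ → Cochain (Signed G m) → Cochain (Signed G m)
    D = resolution shift (suc q) shift-period

    D-linear : ∀ {m} k → Linear (D {m} k)
    D-linear k {φ} {ψ} = resolution-linear shift (suc q) shift-period k {φ} {ψ}

    addZero : ∀ {m} → Signed G m → Signed G (suc m)
    addZero x = here zero (toVec x)

    apex : ∀ {m} → Signed G (suc m)
    apex = here zero (replicate _ nothing)

    -- Both `there x` and `apex` lie below `addZero x`, so this homotopy contracts the embedding
    -- `there` through ascending chains.
    module Cone {m} = Homotopy {Signed G m} there addZero apex
    open Cone public using (K)

    -- The pairing with a chain h_k of dimension k, where h_{k+1} is the cone over the cycle D h_k.
    evaluate : ∀ k → Cochain (Signed G (suc k)) → ℤ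
    evaluate zero    φ = φ (here zero [] ∷ [])
    evaluate (suc k) φ = evaluate k (D k (K φ))

    evaluate-linear : ∀ k {Y : Set} → Linear {Y = Y} (λ φ _ → evaluate k φ)
    evaluate-linear zero    c eq y = eq _
    evaluate-linear (suc k) {Y} {φ} {ψ} c eq y =
      evaluate-linear k {Y} c (D-linear k {K φ} {K ψ} c (Cone.K-linear {φ = φ} {ψ} c eq)) y

    evaluate-cong : ∀ k {φ ψ} → (∀ l → φ l ≡ ψ l) → evaluate k φ ≡ evaluate k ψ
    evaluate-cong k {φ} {ψ} eq = linear-cong {F = λ χ _ → evaluate k χ} (λ {φ} {ψ} → evaluate-linear k {ℕ} {φ} {ψ}) {φ} {ψ} eq zero

    mutual
      -- By `homotopy`, the boundary of a cone is its base up to the cone over the boundary of the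
      -- base. The base D h_k is a cycle by `evaluate-Dδ`, so only the base remains, embedded by
      -- `there`.
      stokes : ∀ k φ → evaluate (suc k) (δ φ) ≡ evaluate k (D k (φ ∘ mapL there))
      stokes k φ = begin
        evaluate k (D k (K (δ φ)))
          ≡⟨ linear-minus (evaluate-linear k)
               (linear-minus (D-linear k) {φ ∘ mapL there} {δ (K φ)} (Cone.homotopy φ)) k ⟩
        evaluate k (D k (φ ∘ mapL there)) ⊖ evaluate k (D k (δ (K φ)))
          ≡⟨ cong (evaluate k (D k (φ ∘ mapL there)) ⊖_) (evaluate-Dδ k (K φ)) ⟩
        evaluate k (D k (φ ∘ mapL there)) ⊖ 0ℤ
          ≡⟨ ℤₚ.+-identityʳ _ ⟩
        evaluate k (D k (φ ∘ mapL there)) ∎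

      -- For k = 0 the chain D h_k is a difference of two points. For larger k, Stokes turns its
      -- boundary into two consecutive maps of the resolution, which compose to 0.
      evaluate-Dδ : ∀ k (ψ : Cochain (Signed G (suc k))) → evaluate k (D k (δ ψ)) ≡ 0ℤ
      evaluate-Dδ zero ψ = ℤₚ.+-inverseʳ (ψ [] ⊖ 0ℤ)
      evaluate-Dδ (suc k) ψ = begin
        evaluate (suc k) (D (suc k) (δ ψ))
          ≡⟨ evaluate-cong (suc k) (resolution-δ (relabel next) (suc q) shift-period (suc k) ψ) ⟩
        evaluate (suc k) (δ (D (suc k) ψ))
          ≡⟨ stokes k (D (suc k) ψ) ⟩
        evaluate k (D k (D (suc k) ψ ∘ mapL there))
          ≡⟨ linear-zero (evaluate-linear k) (λ l → trans
               (linear-cong (D-linear k)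
                 (λ l → sym (resolution-semiconj (suc q) shift-period shift-period (mapL there) there-shift (suc k) ψ l)) l)
               (resolution²≡0 shift (suc q) shift-period k (ψ ∘ mapL there) l)) k ⟩
        0ℤ ∎
        where
        there-shift : ∀ {m} (l : List (Signed G m)) → mapL there (shift l) ≡ shift (mapL there l)
        there-shift l = trans (sym (Listₚ.map-∘ l)) (Listₚ.map-∘ l)

  -- Ascending chains of signed vectors.

  infix 4 _≼_
  _≼_ : ∀ {G : Set} {m} → Vec (Maybe G) m → Vec (Maybe G) m → Set
  v ≼ w = ∀ i {g} → lookup v i ≡ just g → lookup w i ≡ just g

  ∷-≼ : ∀ {G : Set} {m} {v w : Vec (Maybe G) m} g → v ≼ w → (g ∷ v) ≼ (g ∷ w)
  ∷-≼ g v≼w zero    eq = eq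
  ∷-≼ g v≼w (suc i) eq = v≼w i eq

  nothing∷-≼ : ∀ {G : Set} {m} {v w : Vec (Maybe G) m} g → v ≼ w → (nothing ∷ v) ≼ (g ∷ w)
  nothing∷-≼ g v≼w (suc i) eq = v≼w i eq

  nothing-≼ : ∀ {G : Set} {m} (v : Vec (Maybe G) m) → replicate m nothing ≼ v
  nothing-≼ (g ∷ v) (suc i) eq = nothing-≼ v i eq

  map-≼ : ∀ {G : Set} {m} {v w : Vec (Maybe G) m} (f : G → G) → v ≼ w → mapV (mapM f) v ≼ mapV (mapM f) w
  map-≼ {v = v} {w} f v≼w i eq with lookup v i in eqᵥ | trans (sym (Vecₚ.lookup-map i (mapM f) v)) eq
  ... | just g | refl = trans (Vecₚ.lookup-map i (mapM f) w) (cong (mapM f) (v≼w i eqᵥ))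

  Ascending : ∀ {G m} → Vec (Maybe G) m → List (Signed G m) → Set
  Ascending b []       = ⊤
  Ascending b (x ∷ xs) = b ≼ toVec x × Ascending (toVec x) xs

  ascending-relabel : ∀ {G m} (f : G → G) {b b′ : Vec (Maybe G) m} → b′ ≼ mapV (mapM f) b → ∀ l →
                      Ascending b l → Ascending b′ (mapL (relabel f) l)
  ascending-relabel f b′≼b []       _            = tt
  ascending-relabel f {b} {b′} b′≼b (x ∷ xs) (b≼x , asc) =
    subst (b′ ≼_) (sym (toVec-relabel f x)) (λ i eq → map-≼ {v = b} {toVec x} f b≼x i (b′≼b i eq)) ,
    ascending-relabel f {toVec x} (subst (_≼ mapV (mapM f) (toVec x)) (sym (toVec-relabel f x)) (λ i eq → eq)) xs asc

  resolution-vanishes : {X : Set} (τ : X → X) (p : ℕ) (τᵖ : ∀ x → iter τ p x ≡ x) (P : X → Set) → (∀ x → P x → P (τ x)) →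
                        ∀ k {φ : X → ℤ} → (∀ x → P x → φ x ≡ 0ℤ) → ∀ x → P x → resolution τ p τᵖ k φ x ≡ 0ℤ
  resolution-vanishes τ p τᵖ P Pτ zero          van x Px = cong₂ _⊖_ (van (τ x) (Pτ x Px)) (van x Px)
  resolution-vanishes τ p τᵖ P Pτ (suc zero) {φ} van     = lem p
    where
    lem : ∀ j x → P x → orbitSum τ j φ x ≡ 0ℤ
    lem zero    x Px = refl
    lem (suc j) x Px = cong₂ _⊕_ (van x Px) (lem j (τ x) (Pτ x Px))
  resolution-vanishes τ p τᵖ P Pτ (suc (suc k)) = resolution-vanishes τ p τᵖ P Pτ k

  -- The degenerate simplices, on which normalised cochains vanish.
  data Repeats {G : Set} : List G → Set where
    here  : ∀ {a l} → Repeats (a ∷ a ∷ l)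
    there : ∀ {a l} → Repeats l → Repeats (a ∷ l)

  double : ℕ → ℕ
  double zero    = zero
  double (suc i) = suc (suc (double i))

  even-or-odd : ∀ k → ∃ λ i → k ≡ double i ⊎ k ≡ suc (double i)
  even-or-odd zero    = 0 , inj₁ refl
  even-or-odd (suc k) with even-or-odd k
  ... | i , inj₁ eq = i , inj₂ (cong suc eq)
  ... | i , inj₂ eq = suc i , inj₁ (cong suc eq)

  indicator< : ℕ → ℕ → ℤ
  indicator< m n = if m <ᵇ n then 1ℤ else 0ℤ

  indicator<-yes : ∀ {m n} → m < n → indicator< m n ≡ 1ℤ
  indicator<-yes {m} {n} m<n with m <ᵇ n in eq
  ... | true  = refl
  ... | false = contradiction (subst T eq (<⇒<ᵇ m<n)) λ ()

  indicator<-no : ∀ {m n} → n ≤ m → indicator< m n ≡ 0ℤ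
  indicator<-no {m} {n} n≤m with m <ᵇ n in eq
  ... | false = refl
  ... | true  = contradiction (<ᵇ⇒< m n (subst T (sym eq) tt)) (≤⇒≯ n≤m)

  module Tucker (q : ℕ) (p : ℤ) (p≡1+q : p ≡ + suc q) where
    open Cycle q

    G = Fin (suc q)

    Vanishes : ∀ {m} → ℕ → Cochain (Signed G m) → Set
    Vanishes {m} n φ = ∀ l → length l ≡ n × Ascending (replicate m nothing) l → φ l ≡ 0ℤ

    shift-ascending : ∀ {m} n (l : List (Signed G m)) → length l ≡ n × Ascending (replicate m nothing) l →
                      length (shift l) ≡ n × Ascending (replicate m nothing) (shift l)
    shift-ascending n l (len , asc) =
      trans (Listₚ.length-map (relabel next) l) len , ascending-relabel next {replicate _ nothing}
        (nothing-≼ (mapV (mapM next) (replicate _ nothing))) l asc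

    addZero-ascending : ∀ {m} {b : Vec (Maybe G) m} {c} → c ≼ (just zero ∷ b) → ∀ l → Ascending b l →
                        Ascending c (mapL addZero l)
    addZero-ascending c≼b []       _            = tt
    addZero-ascending {b = b} c≼b (x ∷ xs) (b≼x , asc) =
      (λ i eq → ∷-≼ {v = b} {toVec x} (just zero) b≼x i (c≼b i eq)) , addZero-ascending {b = toVec x} (λ i eq → eq) xs asc

    prism-vanishes : ∀ {m} (b : Vec (Maybe G) m) (φ : Cochain (Signed G (suc m))) l → Ascending b l →
                     (∀ l′ → length l′ ≡ suc (length l) × Ascending (nothing ∷ b) l′ → φ l′ ≡ 0ℤ) → Cone.prism φ l ≡ 0ℤ
    prism-vanishes b φ []       asc         van = refl
    prism-vanishes b φ (x ∷ xs) (b≼x , asc) van = cong₂ _⊖_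
      (van _ ( cong (λ n → suc (suc n)) (Listₚ.length-map addZero xs)
             , nothing∷-≼ {v = b} {toVec x} nothing b≼x
             , nothing∷-≼ {v = toVec x} {toVec x} (just zero) (λ i eq → eq)
             , addZero-ascending {b = toVec x} (λ i eq → eq) xs asc))
      (prism-vanishes (toVec x) (λ ys → φ (there x ∷ ys)) xs asc
        (λ l′ (len , asc′) → van (there x ∷ l′) (cong suc len , nothing∷-≼ {v = b} {toVec x} nothing b≼x , asc′)))

    K-vanishes : ∀ {m} n (φ : Cochain (Signed G (suc m))) → Vanishes (suc n) φ → Vanishes n (K φ)
    K-vanishes {m} n φ van l (len , asc) = cong₂ _⊖_
      (van _ ( cong suc (trans (Listₚ.length-map addZero l) len)
             , nothing-≼ (just zero ∷ replicate m nothing)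
             , addZero-ascending {b = replicate m nothing} (λ i eq → eq) l asc))
      (prism-vanishes (replicate m nothing) φ l asc
        (λ l′ (len′ , asc′) → van l′ (trans len′ (cong suc len) , asc′)))

    -- In other words, h_k is supported on ascending chains with `suc k` vertices: the prisms, the
    -- cone from `apex` and the rotations in D all preserve ascending chains.
    evaluate-vanishes : ∀ k φ → Vanishes (suc k) φ → evaluate k φ ≡ 0ℤ
    evaluate-vanishes zero    φ van = van _ (refl , nothing-≼ (just zero ∷ []) , tt)
    evaluate-vanishes (suc k) φ van = evaluate-vanishes k _
      (resolution-vanishes shift (suc q) shift-period _ (shift-ascending (suc k)) k (K-vanishes (suc k) φ van))

    -- Cochains of ℤ/p in low degrees.

    u : G → ℤ
    u a = + toℕ a

    wraps : G → ℤ
    wraps a = indicator< q (suc (toℕ a))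

    w : G → G → ℤ
    w a b = indicator< (toℕ b) (toℕ a)

    -- The representative of b - a in {0, …, q}.
    α : G → G → ℤ
    α a b = (u b ⊖ u a) ⊕ p ⊛ w a b

    -- The carry of the addition (b - a) + (c - b) modulo p.
    β : G → G → G → ℤ
    β a b c = (w b c ⊖ w a c) ⊕ w a b

    u-next : ∀ a → u (next a) ≡ (u a ⊕ 1ℤ) ⊖ p ⊛ wraps a
    u-next a with next-cases a
    ... | inj₁ (a<q , eq) = begin
      + toℕ (next a)            ≡⟨ cong +_ (trans eq (+-comm 1 (toℕ a))) ⟩
      u a ⊕ 1ℤ                  ≡⟨ lem (u a ⊕ 1ℤ) p ⟩
      (u a ⊕ 1ℤ) ⊖ p ⊛ 0ℤ       ≡⟨ cong (λ z → (u a ⊕ 1ℤ) ⊖ p ⊛ z) (sym (indicator<-no a<q)) ⟩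
      (u a ⊕ 1ℤ) ⊖ p ⊛ wraps a  ∎
      where
      lem : ∀ x y → x ≡ x ⊖ y ⊛ 0ℤ
      lem = ring-∀
    ... | inj₂ (a≡q , eq) = begin
      + toℕ (next a)            ≡⟨ cong +_ eq ⟩
      0ℤ                        ≡⟨ lem p ⟩
      p ⊖ p ⊛ 1ℤ                ≡⟨ cong₂ (λ x z → x ⊖ p ⊛ z) (trans p≡1+q (cong (λ n → + n) (trans (cong suc (sym a≡q)) (+-comm 1 (toℕ a)))))
                                     (sym (indicator<-yes (s≤s (≤-reflexive (sym a≡q))))) ⟩
      (u a ⊕ 1ℤ) ⊖ p ⊛ wraps a  ∎
      where
      lem : ∀ x → 0ℤ ≡ x ⊖ x ⊛ 1ℤ
      lem = ring-∀

    -- The change of w is the coboundary of `wraps`. It cancels against the change of `u` in α, and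
    -- it drops out of β, which is the coboundary of w.
    w-next : ∀ a b → w (next a) (next b) ≡ (w a b ⊕ wraps b) ⊖ wraps a
    w-next a b = lem (next-cases a) (next-cases b)
      where
      Cases : ℕ → ℕ → Set
      Cases m m′ = (m < q × m′ ≡ suc m) ⊎ (m ≡ q × m′ ≡ 0)
      ring : ∀ x → x ≡ (x ⊕ 0ℤ) ⊖ 0ℤ
      ring = ring-∀
      lem : ∀ {m m′ n n′} → Cases m m′ → Cases n n′ →
            indicator< n′ m′ ≡ (indicator< n m ⊕ indicator< q (suc n)) ⊖ indicator< q (suc m)
      lem {m} {n = n} (inj₁ (m<q , refl)) (inj₁ (n<q , refl))
        rewrite indicator<-no m<q | indicator<-no n<q = ring (indicator< n m)
      lem (inj₁ (m<q , refl)) (inj₂ (refl , refl))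
        rewrite indicator<-no m<q | indicator<-no (<⇒≤ m<q) | indicator<-yes (≤-refl {suc q}) = refl
      lem (inj₂ (refl , refl)) (inj₁ (n<q , refl))
        rewrite indicator<-no n<q | indicator<-yes n<q | indicator<-yes (≤-refl {suc q}) = refl
      lem (inj₂ (refl , refl)) (inj₂ (refl , refl))
        rewrite indicator<-yes (≤-refl {suc q}) | indicator<-no (≤-refl {q}) = refl

    α-next : ∀ a b → α (next a) (next b) ≡ α a b
    α-next a b rewrite u-next a | u-next b | w-next a b = lem p (u a) (u b) (wraps a) (wraps b) (w a b)
      where
      lem : ∀ p a b e f w → (((b ⊕ 1ℤ) ⊖ p ⊛ f) ⊖ ((a ⊕ 1ℤ) ⊖ p ⊛ e)) ⊕ p ⊛ ((w ⊕ f) ⊖ e) ≡ (b ⊖ a) ⊕ p ⊛ w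
      lem = ring-∀

    β-next : ∀ a b c → β (next a) (next b) (next c) ≡ β a b c
    β-next a b c rewrite w-next a b | w-next b c | w-next a c = lem (w b c) (w a c) (w a b) (wraps a) (wraps b) (wraps c)
      where
      lem : ∀ x y z e f g → (((x ⊕ g) ⊖ f) ⊖ ((y ⊕ g) ⊖ e)) ⊕ ((z ⊕ f) ⊖ e) ≡ (x ⊖ y) ⊕ z
      lem = ring-∀

    w-refl : ∀ a → w a a ≡ 0ℤ
    w-refl a = indicator<-no (≤-refl {toℕ a})

    orbitSum-u : ∀ a → orbitSum next (suc q) u a ≡ orbitSum next (suc q) u zero
    orbitSum-u a = trans (cong (orbitSum next (suc q) u) (sym (iter-toℕ a))) (lem (toℕ a))
      where
      S = orbitSum next (suc q) u
      cancel : ∀ x y → x ⊖ y ≡ 0ℤ → x ≡ y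
      cancel x y = ℤₚ.i-j≡0⇒i≡j x y
      lem : ∀ j → S (iter next j zero) ≡ S zero
      lem zero    = refl
      lem (suc j) = trans (cong S (iter-suc next j zero))
        (trans (cancel _ _ (diff-orbitSum≡0 next (suc q) iter-period u (iter next j zero))) (lem j))

    nextPair : G × G → G × G
    nextPair (a , b) = next a , next b

    -- Sum the definition of α over the orbit. As α is invariant, the result is p times α; the
    -- contributions of `u b` and `u a` cancel, which leaves p times the orbit sum of w, and p can
    -- be cancelled.
    orbitSum-w : ∀ a b → orbitSum nextPair (suc q) (λ (a , b) → w a b) (a , b) ≡ α a b
    orbitSum-w a b = ℤₚ.*-cancelˡ-≡ p _ _ {{subst ℤ.NonZero (sym p≡1+q) _}} (begin
      p ⊛ W                        ≡⟨ lem₁ (p ⊛ W) U ⟩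
      (U ⊖ U) ⊕ p ⊛ W              ≡⟨ cong₂ (λ x y → (x ⊖ y) ⊕ p ⊛ W) (sym (orbitSum-u b)) (sym (orbitSum-u a)) ⟩
      (orbitSum next (suc q) u b ⊖ orbitSum next (suc q) u a) ⊕ p ⊛ W
                                   ≡⟨ cong (_⊕ p ⊛ W) (cong₂ _⊖_ (sym (orbitSum-semiconj proj₂ (λ _ → refl) (suc q) u (a , b)))
                                                                (sym (orbitSum-semiconj proj₁ (λ _ → refl) (suc q) u (a , b)))) ⟩
      (N (u ∘ proj₂) ⊖ N (u ∘ proj₁)) ⊕ p ⊛ W
                                   ≡⟨ cong (_⊕ p ⊛ W) (sym (linear-minus (λ {φ} {ψ} → orbitSum-linear nextPair (suc q) {φ} {ψ})
                                        {u ∘ proj₂} {u ∘ proj₁} {λ (a , b) → u b ⊖ u a} (λ _ → refl) (a , b))) ⟩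
      N (λ (a , b) → u b ⊖ u a) ⊕ p ⊛ W
                                   ≡⟨ sym (orbitSum-linear nextPair (suc q) {λ (a , b) → u b ⊖ u a} {λ (a , b) → w a b}
                                        {λ (a , b) → α a b} p (λ _ → refl) (a , b)) ⟩
      N (λ (a , b) → α a b)        ≡⟨ trans (invariant (suc q) a b) (cong (_⊛ α a b) (sym p≡1+q)) ⟩
      p ⊛ α a b                    ∎)
      where
      N = λ φ → orbitSum nextPair (suc q) φ (a , b)
      W = N (λ (a , b) → w a b)
      U = orbitSum next (suc q) u zero
      lem₁ : ∀ x y → x ≡ (y ⊖ y) ⊕ x
      lem₁ = ring-∀
      ring : ∀ j c → c ⊕ j ⊛ c ≡ (1ℤ ⊕ j) ⊛ c
      ring = ring-∀
      invariant : ∀ j a b → orbitSum nextPair j (λ (a , b) → α a b) (a , b) ≡ + j ⊛ α a b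
      invariant zero    a b = refl
      invariant (suc j) a b = trans
        (cong (α a b ⊕_) (trans (invariant j (next a) (next b)) (cong (+ j ⊛_) (α-next a b)))) (ring (+ j) (α a b))

    -- Cup products and the cocycles in all degrees.

    infixr 7 _⌣₀_ _⌣₁_ _⌣₂_
    _⌣₀_ : (G → ℤ) → Cochain G → Cochain G
    (f ⌣₀ φ) (a ∷ l) = f a ⊛ φ (a ∷ l)
    (f ⌣₀ φ) []      = 0ℤ

    _⌣₁_ : (G → G → ℤ) → Cochain G → Cochain G
    (f ⌣₁ φ) (a ∷ b ∷ l) = f a b ⊛ φ (b ∷ l)
    (f ⌣₁ φ) _           = 0ℤ

    _⌣₂_ : (G → G → G → ℤ) → Cochain G → Cochain G
    (f ⌣₂ φ) (a ∷ b ∷ c ∷ l) = f a b c ⊛ φ (c ∷ l)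
    (f ⌣₂ φ) _               = 0ℤ

    -- The i-th cup power of β, of degree 2i. Together with `α ⌣₁ ε i` in degree 2i + 1, these are
    -- the standard generators of the cohomology of ℤ/p modulo p.
    ε : ℕ → Cochain G
    ε zero    (a ∷ []) = 1ℤ
    ε zero    _        = 0ℤ
    ε (suc i) = β ⌣₂ ε i

    δ-scale : ∀ {A : Set} c (φ : Cochain A) l → δ (λ ys → c ⊛ φ ys) l ≡ c ⊛ δ φ l
    δ-scale c φ l = trans (δ-linear {φ = λ _ → 0ℤ} {φ} c (λ ys → sym (ℤₚ.+-identityˡ _)) l)
      (trans (cong (_⊕ c ⊛ δ φ l) (linear-zero δ-linear (λ _ → refl) l)) (ℤₚ.+-identityˡ _))

    module _ (φ : Cochain G) (δφ≡0 : ∀ l → δ φ l ≡ 0ℤ) where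

      closed-at : ∀ a b l → δ (λ ys → φ (a ∷ b ∷ ys)) l ≡ φ (a ∷ l) ⊖ φ (b ∷ l)
      closed-at a b l = begin
        d                                           ≡⟨ lem (φ (b ∷ l)) (φ (a ∷ l)) d ⟩
        (φ (b ∷ l) ⊖ (φ (a ∷ l) ⊖ d)) ⊕ (φ (a ∷ l) ⊖ φ (b ∷ l)) ≡⟨ cong (_⊕ (φ (a ∷ l) ⊖ φ (b ∷ l))) (δφ≡0 (a ∷ b ∷ l)) ⟩
        0ℤ ⊕ (φ (a ∷ l) ⊖ φ (b ∷ l))                ≡⟨ ℤₚ.+-identityˡ _ ⟩
        φ (a ∷ l) ⊖ φ (b ∷ l)                       ∎
        where
        d = δ (λ ys → φ (a ∷ b ∷ ys)) l
        lem : ∀ x y d → d ≡ (x ⊖ (y ⊖ d)) ⊕ (y ⊖ x)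
        lem = ring-∀

      -- The Leibniz rule: β is the coboundary of w, and φ is closed.
      δ-w⌣ : ∀ l → (β ⌣₂ φ) l ≡ δ (w ⌣₁ φ) l
      δ-w⌣ []       = refl
      δ-w⌣ (a ∷ []) = refl
      δ-w⌣ (a ∷ b ∷ []) = refl
      δ-w⌣ (a ∷ b ∷ c ∷ l) = begin
        β a b c ⊛ φ (c ∷ l)
          ≡⟨ lem (w b c) (w a c) (w a b) (φ (c ∷ l)) (φ (b ∷ l)) ⟩
        w b c ⊛ φ (c ∷ l) ⊖ (w a c ⊛ φ (c ∷ l) ⊖ (w a b ⊛ φ (b ∷ l) ⊖ w a b ⊛ (φ (b ∷ l) ⊖ φ (c ∷ l))))
          ≡⟨ cong (λ z → w b c ⊛ φ (c ∷ l) ⊖ (w a c ⊛ φ (c ∷ l) ⊖ (w a b ⊛ φ (b ∷ l) ⊖ z)))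
               (sym (trans (δ-scale (w a b) (λ ys → φ (b ∷ c ∷ ys)) l) (cong (w a b ⊛_) (closed-at b c l)))) ⟩
        δ (w ⌣₁ φ) (a ∷ b ∷ c ∷ l) ∎
        where
        lem : ∀ x y z f g → ((x ⊖ y) ⊕ z) ⊛ f ≡ x ⊛ f ⊖ (y ⊛ f ⊖ (z ⊛ g ⊖ z ⊛ (g ⊖ f)))
        lem = ring-∀

      -- α is the coboundary of u plus p w, hence the same rule with a correction that vanishes
      -- modulo p.
      δ-u⌣ : ∀ l → (α ⌣₁ φ) l ≡ δ (u ⌣₀ φ) l ⊕ p ⊛ (w ⌣₁ φ) l
      δ-u⌣ []       = sym (trans (ℤₚ.+-identityˡ _) (ℤₚ.*-zeroʳ p))
      δ-u⌣ (a ∷ []) = sym (trans (ℤₚ.+-identityˡ _) (ℤₚ.*-zeroʳ p))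
      δ-u⌣ (a ∷ b ∷ l) = begin
        α a b ⊛ φ (b ∷ l)
          ≡⟨ lem p (u a) (u b) (w a b) (φ (a ∷ l)) (φ (b ∷ l)) ⟩
        (u b ⊛ φ (b ∷ l) ⊖ (u a ⊛ φ (a ∷ l) ⊖ u a ⊛ (φ (a ∷ l) ⊖ φ (b ∷ l)))) ⊕ p ⊛ (w a b ⊛ φ (b ∷ l))
          ≡⟨ cong (λ z → (u b ⊛ φ (b ∷ l) ⊖ (u a ⊛ φ (a ∷ l) ⊖ z)) ⊕ p ⊛ (w a b ⊛ φ (b ∷ l)))
               (sym (trans (δ-scale (u a) (λ ys → φ (a ∷ b ∷ ys)) l) (cong (u a ⊛_) (closed-at a b l)))) ⟩
        δ (u ⌣₀ φ) (a ∷ b ∷ l) ⊕ p ⊛ (w a b ⊛ φ (b ∷ l)) ∎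
        where
        lem : ∀ p a b w f g → ((b ⊖ a) ⊕ p ⊛ w) ⊛ g ≡ (b ⊛ g ⊖ (a ⊛ f ⊖ a ⊛ (f ⊖ g))) ⊕ p ⊛ (w ⊛ g)
        lem = ring-∀

    ε-closed : ∀ i l → δ (ε i) l ≡ 0ℤ
    ε-closed zero    []              = refl
    ε-closed zero    (a ∷ [])        = refl
    ε-closed zero    (a ∷ b ∷ [])    = refl
    ε-closed zero    (a ∷ b ∷ c ∷ l) = trans (ℤₚ.+-identityˡ _) (cong (λ z → ⊝ (0ℤ ⊖ (0ℤ ⊖ z))) (linear-zero δ-linear (λ _ → refl) l))
    ε-closed (suc i) l = trans (linear-cong δ-linear (δ-w⌣ (ε i) (ε-closed i)) l) (δδ≡0 (w ⌣₁ ε i) l)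

    ε-next : ∀ i l → ε i (mapL next l) ≡ ε i l
    ε-next zero    []              = refl
    ε-next zero    (a ∷ [])        = refl
    ε-next zero    (a ∷ b ∷ l)     = refl
    ε-next (suc i) []              = refl
    ε-next (suc i) (a ∷ [])        = refl
    ε-next (suc i) (a ∷ b ∷ [])    = refl
    ε-next (suc i) (a ∷ b ∷ c ∷ l) = cong₂ _⊛_ (β-next a b c) (ε-next i (c ∷ l))

    ε-[] : ∀ i → ε i [] ≡ 0ℤ
    ε-[] zero    = refl
    ε-[] (suc i) = refl

    -- β vanishes when two neighbouring arguments agree, and any two neighbours in the list lie in a
    -- common factor because consecutive factors share an end point.
    ε-repeats : ∀ i l → Repeats l → ε i l ≡ 0ℤ
    ε-repeats zero    (a ∷ b ∷ l)      r = refl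
    ε-repeats zero    (a ∷ [])         (there ())
    ε-repeats (suc i) (a ∷ [])         (there ())
    ε-repeats (suc i) (a ∷ b ∷ [])     r = refl
    ε-repeats (suc i) (a ∷ .a ∷ c ∷ l) here =
      trans (cong (_⊛ ε i (c ∷ l)) (trans (cong ((w a c ⊖ w a c) ⊕_) (w-refl a)) (lem (w a c)))) (ℤₚ.*-zeroˡ (ε i (c ∷ l)))
      where
      lem : ∀ x → (x ⊖ x) ⊕ 0ℤ ≡ 0ℤ
      lem = ring-∀
    ε-repeats (suc i) (a ∷ b ∷ .b ∷ l) (there here) =
      trans (cong (_⊛ ε i (b ∷ l)) (trans (cong (λ z → (z ⊖ w a b) ⊕ w a b) (w-refl b)) (lem (w a b)))) (ℤₚ.*-zeroˡ (ε i (b ∷ l)))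
      where
      lem : ∀ x → (0ℤ ⊖ x) ⊕ x ≡ 0ℤ
      lem = ring-∀
    ε-repeats (suc i) (a ∷ b ∷ c ∷ l) (there (there r)) =
      trans (cong (β a b c ⊛_) (ε-repeats i (c ∷ l) r)) (ℤₚ.*-zeroʳ (β a b c))

    α⌣ε-repeats : ∀ i l → Repeats l → (α ⌣₁ ε i) l ≡ 0ℤ
    α⌣ε-repeats i (a ∷ []) (there ())
    α⌣ε-repeats i (a ∷ .a ∷ l) here =
      trans (cong (_⊛ ε i (a ∷ l)) (trans (cong (λ z → (u a ⊖ u a) ⊕ p ⊛ z) (w-refl a)) (lem p (u a)))) (ℤₚ.*-zeroˡ (ε i (a ∷ l)))
      where
      lem : ∀ p x → (x ⊖ x) ⊕ p ⊛ 0ℤ ≡ 0ℤ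
      lem = ring-∀
    α⌣ε-repeats i (a ∷ b ∷ l) (there r) =
      trans (cong (α a b ⊛_) (ε-repeats i (b ∷ l) r)) (ℤₚ.*-zeroʳ (α a b))

    -- ε i is invariant, so the orbit sum acts on w alone.
    orbitSum-w⌣ε : ∀ i l → orbitSum (mapL next) (suc q) (w ⌣₁ ε i) l ≡ (α ⌣₁ ε i) l
    orbitSum-w⌣ε i []       = lem (suc q)
      where
      lem : ∀ j → orbitSum (mapL next) j (w ⌣₁ ε i) [] ≡ 0ℤ
      lem zero    = refl
      lem (suc j) = trans (ℤₚ.+-identityˡ _) (lem j)
    orbitSum-w⌣ε i (a ∷ []) = lem (suc q) a
      where
      lem : ∀ j a → orbitSum (mapL next) j (w ⌣₁ ε i) (a ∷ []) ≡ 0ℤ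
      lem zero    a = refl
      lem (suc j) a = trans (ℤₚ.+-identityˡ _) (lem j (next a))
    orbitSum-w⌣ε i (a ∷ b ∷ l) = trans (lem (suc q) a b l) (cong (_⊛ ε i (b ∷ l)) (orbitSum-w a b))
      where
      lem : ∀ j a b l → orbitSum (mapL next) j (w ⌣₁ ε i) (a ∷ b ∷ l) ≡
                        orbitSum nextPair j (λ (a , b) → w a b) (a , b) ⊛ ε i (b ∷ l)
      lem zero    a b l = sym (ℤₚ.*-zeroˡ (ε i (b ∷ l)))
      lem (suc j) a b l = trans
        (cong (w a b ⊛ ε i (b ∷ l) ⊕_)
          (trans (lem j (next a) (next b) (mapL next l))
                 (cong (orbitSum nextPair j (λ (a , b) → w a b) (next a , next b) ⊛_) (ε-next i (b ∷ l)))))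
        (sym (ℤₚ.*-distribʳ-+ (ε i (b ∷ l)) (w a b) _))

    -- ε i is invariant, while u grows by 1 modulo p under `next`.
    diff-u⌣ε : ∀ i l → diff (mapL next) (u ⌣₀ ε i) l ≡ ε i l ⊕ p ⊛ ((λ a → ⊝ wraps a) ⌣₀ ε i) l
    diff-u⌣ε i []      = sym (trans (cong₂ _⊕_ (ε-[] i) (ℤₚ.*-zeroʳ p)) refl)
    diff-u⌣ε i (a ∷ l) = trans (cong₂ (λ x y → x ⊛ y ⊖ u a ⊛ ε i (a ∷ l)) (u-next a) (ε-next i (a ∷ l)))
      (lem p (u a) (wraps a) (ε i (a ∷ l)))
      where
      lem : ∀ p a e x → ((a ⊕ 1ℤ) ⊖ p ⊛ e) ⊛ x ⊖ a ⊛ x ≡ x ⊕ p ⊛ ((⊝ e) ⊛ x)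
      lem = ring-∀

    -- Evaluation of the pulled-back cocycles.

    Equivariant : ∀ {m} → (Signed G m → G) → Set
    Equivariant s = ∀ x → s (relabel next x) ≡ next (s x)

    mapL-equivariant : ∀ {m} {s : Signed G m → G} → Equivariant s → ∀ l → mapL s (shift l) ≡ mapL next (mapL s l)
    mapL-equivariant equiv l =
      trans (sym (Listₚ.map-∘ l)) (trans (Listₚ.map-cong equiv l) (Listₚ.map-∘ l))

    D-even : ∀ {m} i (φ : Cochain (Signed G m)) l → D (double i) φ l ≡ diff shift φ l
    D-even zero    φ l = refl
    D-even (suc i) φ l = D-even i φ l

    D-odd : ∀ {m} i (φ : Cochain (Signed G m)) l → D (suc (double i)) φ l ≡ orbitSum shift (suc q) φ l
    D-odd zero    φ l = refl
    D-odd (suc i) φ l = D-odd i φ l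

    stokes-pull : ∀ k (ψ : Cochain G) (s : Signed G (suc (suc k)) → G) →
                  evaluate (suc k) (δ ψ ∘ mapL s) ≡ evaluate k (D k (ψ ∘ mapL (s ∘ there)))
    stokes-pull k ψ s = begin
      evaluate (suc k) (δ ψ ∘ mapL s)          ≡⟨ evaluate-cong (suc k) (λ l → sym (δ-natural s ψ l)) ⟩
      evaluate (suc k) (δ (ψ ∘ mapL s))        ≡⟨ stokes k (ψ ∘ mapL s) ⟩
      evaluate k (D k (ψ ∘ mapL s ∘ mapL there)) ≡⟨ evaluate-cong k (linear-cong (D-linear k) (λ l → cong ψ (sym (Listₚ.map-∘ l)))) ⟩
      evaluate k (D k (ψ ∘ mapL (s ∘ there)))  ∎

    mutual
      -- In degree 0, ε is 1 at the single point h_0. Otherwise `ε (suc i)` is the coboundary of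
      -- `w ⌣₁ ε i`, and Stokes produces the orbit sum of the latter, which is `α ⌣₁ ε i` one
      -- dimension lower.
      evaluate-ε : ∀ i (s : Signed G (suc (double i)) → G) → Equivariant s →
                   ∃ λ z → evaluate (double i) (ε i ∘ mapL s) ≡ 1ℤ ⊕ p ⊛ z
      evaluate-ε zero    s equiv = 0ℤ , sym (trans (cong (1ℤ ⊕_) (ℤₚ.*-zeroʳ p)) refl)
      evaluate-ε (suc i) s equiv with evaluate-α⌣ε i (s ∘ there) (equiv ∘ there)
      ... | z , eq = z , trans lem eq
        where
        k = suc (double i)
        lem : evaluate (suc k) (ε (suc i) ∘ mapL s) ≡ evaluate k ((α ⌣₁ ε i) ∘ mapL (s ∘ there))
        lem = begin
          evaluate (suc k) (ε (suc i) ∘ mapL s)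
            ≡⟨ evaluate-cong (suc k) (δ-w⌣ (ε i) (ε-closed i) ∘ mapL s) ⟩
          evaluate (suc k) (δ (w ⌣₁ ε i) ∘ mapL s)
            ≡⟨ stokes-pull k (w ⌣₁ ε i) s ⟩
          evaluate k (D k ((w ⌣₁ ε i) ∘ mapL (s ∘ there)))
            ≡⟨ evaluate-cong k (λ l → trans (D-odd i _ l)
                 (trans (orbitSum-semiconj (mapL (s ∘ there)) (mapL-equivariant (equiv ∘ there)) (suc q) (w ⌣₁ ε i) l)
                        (orbitSum-w⌣ε i (mapL (s ∘ there) l)))) ⟩
          evaluate k ((α ⌣₁ ε i) ∘ mapL (s ∘ there)) ∎

      -- Modulo p the cochain is the coboundary of `u ⌣₀ ε i`, and Stokes produces the difference of
      -- the latter, which is `ε i` modulo p. The terms z₁ and z₂ collect the multiples of p.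
      evaluate-α⌣ε : ∀ i (s : Signed G (suc (suc (double i))) → G) → Equivariant s →
                     ∃ λ z → evaluate (suc (double i)) ((α ⌣₁ ε i) ∘ mapL s) ≡ 1ℤ ⊕ p ⊛ z
      evaluate-α⌣ε i s equiv with evaluate-ε i (s ∘ there) (equiv ∘ there)
      ... | z , eq = (z ⊕ z₁) ⊕ z₂ , (begin
          evaluate (suc k) ((α ⌣₁ ε i) ∘ mapL s)
            ≡⟨ evaluate-linear (suc k) {ℕ} {δ (u ⌣₀ ε i) ∘ mapL s} {(w ⌣₁ ε i) ∘ mapL s} p (δ-u⌣ (ε i) (ε-closed i) ∘ mapL s) 0 ⟩
          evaluate (suc k) (δ (u ⌣₀ ε i) ∘ mapL s) ⊕ p ⊛ z₂
            ≡⟨ cong (_⊕ p ⊛ z₂) (stokes-pull k (u ⌣₀ ε i) s) ⟩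
          evaluate k (D k ((u ⌣₀ ε i) ∘ mapL s′)) ⊕ p ⊛ z₂
            ≡⟨ cong (_⊕ p ⊛ z₂) (evaluate-linear k {ℕ} {ε i ∘ mapL s′} {((λ a → ⊝ wraps a) ⌣₀ ε i) ∘ mapL s′} p (λ l →
                 trans (D-even i _ l)
                 (trans (cong (λ l′ → (u ⌣₀ ε i) l′ ⊖ (u ⌣₀ ε i) (mapL s′ l)) (mapL-equivariant (equiv ∘ there) l))
                        (diff-u⌣ε i (mapL s′ l)))) 0) ⟩
          (evaluate k (ε i ∘ mapL s′) ⊕ p ⊛ z₁) ⊕ p ⊛ z₂
            ≡⟨ cong (λ x → (x ⊕ p ⊛ z₁) ⊕ p ⊛ z₂) eq ⟩
          ((1ℤ ⊕ p ⊛ z) ⊕ p ⊛ z₁) ⊕ p ⊛ z₂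
            ≡⟨ ring p z z₁ z₂ ⟩
          1ℤ ⊕ p ⊛ ((z ⊕ z₁) ⊕ z₂) ∎)
        where
        k  = double i
        s′ = s ∘ there
        z₁ = evaluate k (((λ a → ⊝ wraps a) ⌣₀ ε i) ∘ mapL s′)
        z₂ = evaluate (suc k) ((w ⌣₁ ε i) ∘ mapL s)
        ring : ∀ p x y z → ((1ℤ ⊕ p ⊛ x) ⊕ p ⊛ y) ⊕ p ⊛ z ≡ 1ℤ ⊕ p ⊛ ((x ⊕ y) ⊕ z)
        ring = ring-∀

    1+pz≢0 : 1 ≤ q → ∀ z → ¬ (0ℤ ≡ 1ℤ ⊕ p ⊛ z)
    1+pz≢0 1≤q z eq = <⇒≢ (s≤s 1≤q) (sym (m*n≡1⇒m≡1 (suc q) (abs (⊝ z)) (trans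
      (cong (λ x → abs x * abs (⊝ z)) (sym p≡1+q))
      (trans (sym (ℤₚ.abs-* p (⊝ z))) (cong abs (begin
      p ⊛ (⊝ z)             ≡⟨ lem p z ⟩
      1ℤ ⊖ (1ℤ ⊕ p ⊛ z)     ≡⟨ cong (1ℤ ⊖_) (sym eq) ⟩
      1ℤ                    ∎))))))
      where
      lem : ∀ p z → p ⊛ (⊝ z) ≡ 1ℤ ⊖ (1ℤ ⊕ p ⊛ z)
      lem = ring-∀

    AllRepeat : ∀ {m} → (Signed G m → G) → Set
    AllRepeat {m} s = ∀ l → length l ≡ m × Ascending (replicate m nothing) l → Repeats (mapL s l)

    vanishes-if-repeat : ∀ k (s : Signed G (suc k) → G) (φ : Cochain G) → (∀ l → Repeats l → φ l ≡ 0ℤ) →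
                         AllRepeat s → evaluate k (φ ∘ mapL s) ≡ 0ℤ
    vanishes-if-repeat k s φ van rep = evaluate-vanishes k (φ ∘ mapL s) (λ l asc → van (mapL s l) (rep l asc))

    -- If all chains had a repeat, the pulled-back cocycle of degree k would evaluate to 0, whereas
    -- its value is 1 modulo p and p ≥ 2.
    sign-without-repeat : 1 ≤ q → ∀ k (s : Signed G (suc k) → G) → Equivariant s → ¬ AllRepeat s
    sign-without-repeat 1≤q k = go k (even-or-odd k)
      where
      go : ∀ k → (∃ λ i → k ≡ double i ⊎ k ≡ suc (double i)) →
           ∀ (s : Signed G (suc k) → G) → Equivariant s → ¬ AllRepeat s
      go _ (i , inj₁ refl) s equiv rep =
        let z , eq = evaluate-ε i s equiv
        in 1+pz≢0 1≤q z (trans (sym (vanishes-if-repeat (double i) s (ε i) (ε-repeats i) rep)) eq)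
      go _ (i , inj₂ refl) s equiv rep =
        let z , eq = evaluate-α⌣ε i s equiv
        in 1+pz≢0 1≤q z (trans (sym (vanishes-if-repeat (suc (double i)) s (α ⌣₁ ε i) (α⌣ε-repeats i) rep)) eq)

    -- A chain of `suc k` vectors cannot rise at every step within the levels 1, ..., k, so some two
    -- neighbours have equal signs.
    tucker : 1 ≤ q → ∀ k (s : Signed G (suc k) → G) → Equivariant s →
             (level : Signed G (suc k) → ℕ) → (∀ x → 1 ≤ level x) → (∀ x → level x ≤ k) →
             ¬ (∀ x y → toVec x ≼ toVec y → level x < level y ⊎ s x ≡ s y)
    tucker 1≤q k s equiv level 1≤level level≤k ascend = sign-without-repeat 1≤q k s equiv all-repeat
      where
      repeat-or-rise : ∀ x xs → Ascending (toVec x) xs → Repeats (mapL s (x ∷ xs)) ⊎ level x + length xs ≤ k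
      repeat-or-rise x []       _            = inj₂ (≤-trans (≤-reflexive (+-identityʳ (level x))) (level≤k x))
      repeat-or-rise x (y ∷ ys) (x≼y , asc) with repeat-or-rise y ys asc | ascend x y x≼y
      ... | inj₁ rep | _       = inj₁ (there rep)
      ... | inj₂ _   | inj₂ eq = inj₁ (subst (λ a → Repeats (s x ∷ a ∷ mapL s ys)) eq here)
      ... | inj₂ le  | inj₁ lt = inj₂ (≤-trans (≤-reflexive (+-suc (level x) (length ys)))
                                                  (≤-trans (+-monoˡ-≤ (length ys) lt) le))

      all-repeat : AllRepeat s
      all-repeat (x ∷ xs) (len , _ , asc) with repeat-or-rise x xs asc
      ... | inj₁ rep = rep
      ... | inj₂ le  = contradiction
        (≤-trans (+-mono-≤ (1≤level x) (≤-reflexive (sym (suc-injective len)))) le) (<⇒≱ ≤-refl)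

open EquivariantCochains
  using (iter; iter-suc; next; toℕ-next-<; next-≡; next-cases; iter-period; Signed; here; there; toVec; toVec-injective; relabel; toVec-relabel; _≼_; module Tucker)

-- Sums and arithmetic modulo p

Σ≡∑ : ∀ n (f : Fin n → ℕ) → Σ[ n ] f ≡ ∑ f
Σ≡∑ zero    f = refl
Σ≡∑ (suc n) f = cong (f zero +_) (trans
  (cong ListAction.sum (trans (Listₚ.map-tabulate suc f) (sym (Listₚ.map-tabulate id (f ∘ suc)))))
  (Σ≡∑ n (f ∘ suc)))

∑-mono : ∀ {n} {f g : Fin n → ℕ} → (∀ i → f i ≤ g i) → ∑ f ≤ ∑ g
∑-mono {zero}  f≤g = z≤n
∑-mono {suc n} f≤g = +-mono-≤ (f≤g zero) (∑-mono (f≤g ∘ suc))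

+-mono-≡ : ∀ {a b c d} → a ≤ c → b ≤ d → a + b ≡ c + d → a ≡ c × b ≡ d
+-mono-≡ {a} {b} {c} {d} a≤c b≤d eq = a≡c , +-cancelˡ-≡ a b d (trans eq (cong (_+ d) (sym a≡c)))
  where
  a≡c = ≤-antisym a≤c (+-cancelʳ-≤ d c a (≤-trans (≤-reflexive (sym eq)) (+-monoʳ-≤ a b≤d)))

∑-mono-≡ : ∀ {n} {f g : Fin n → ℕ} → (∀ i → f i ≤ g i) → ∑ f ≡ ∑ g → ∀ i → f i ≡ g i
∑-mono-≡ f≤g eq zero    = proj₁ (+-mono-≡ (f≤g zero) (∑-mono (f≤g ∘ suc)) eq)
∑-mono-≡ f≤g eq (suc i) = ∑-mono-≡ (f≤g ∘ suc) (proj₂ (+-mono-≡ (f≤g zero) (∑-mono (f≤g ∘ suc)) eq)) i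

∑≡0 : ∀ {n} {f : Fin n → ℕ} → (∀ i → f i ≡ 0) → ∑ f ≡ 0
∑≡0 {zero}  eq = refl
∑≡0 {suc n} eq = cong₂ _+_ (eq zero) (∑≡0 (eq ∘ suc))

term≤∑ : ∀ {n} (f : Fin n → ℕ) i → f i ≤ ∑ f
term≤∑ f zero    = m≤m+n (f zero) _
term≤∑ f (suc i) = ≤-trans (term≤∑ (f ∘ suc) i) (m≤n+m _ (f zero))

∑≡0⁻ : ∀ {n} (f : Fin n → ℕ) → ∑ f ≡ 0 → ∀ i → f i ≡ 0
∑≡0⁻ f eq i = n≤0⇒n≡0 (≤-trans (term≤∑ f i) (≤-reflexive eq))

∑-const : ∀ n c → ∑ {n} (λ _ → c) ≡ n * c
∑-const zero    c = refl
∑-const (suc n) c = cong (c +_) (∑-const n c)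

-- A nonnegative integer weight of total 1 is concentrated in one point.
∑-point : ∀ {n} (f g : Fin n → ℕ) a → ∑ f ≡ 1 → f a ≡ 1 → ∑ (λ i → g i * f i) ≡ g a
∑-point f g zero ∑f≡1 fa≡1 = trans (cong₂ _+_ (trans (cong (g zero *_) fa≡1) (*-identityʳ (g zero)))
    (∑≡0 (λ i → trans (cong (g (suc i) *_) (rest i)) (*-zeroʳ (g (suc i)))))) (+-identityʳ (g zero))
  where
  rest : ∀ i → f (suc i) ≡ 0
  rest = ∑≡0⁻ (f ∘ suc) (suc-injective (trans (cong (_+ ∑ (f ∘ suc)) (sym fa≡1)) ∑f≡1))
∑-point f g (suc a) ∑f≡1 fa≡1 =
  cong₂ _+_ (trans (cong (g zero *_) f₀≡0) (*-zeroʳ (g zero)))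
    (∑-point (f ∘ suc) (g ∘ suc) a (trans (cong (_+ ∑ (f ∘ suc)) (sym f₀≡0)) ∑f≡1) fa≡1)
  where
  f₀≡0 : f zero ≡ 0
  f₀≡0 = n≤0⇒n≡0 (+-cancelʳ-≤ 1 (f zero) 0
    (≤-trans (+-monoʳ-≤ (f zero) (≤-trans (≤-reflexive (sym fa≡1)) (term≤∑ (f ∘ suc) a))) (≤-reflexive ∑f≡1)))

module Modular (q : ℕ) where

  private
    p = suc q
    G = Fin p

  infix 4 _≈_
  record _≈_ (a b : ℕ) : Set where
    constructor mk≈
    field %≡ : a % p ≡ b % p
  open _≈_ public

  ≈-refl : ∀ {a} → a ≈ a
  ≈-refl = mk≈ refl

  ≡⇒≈ : ∀ {a b} → a ≡ b → a ≈ b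
  ≡⇒≈ refl = ≈-refl

  ≈-sym : ∀ {a b} → a ≈ b → b ≈ a
  ≈-sym (mk≈ eq) = mk≈ (sym eq)

  ≈-trans : ∀ {a b c} → a ≈ b → b ≈ c → a ≈ c
  ≈-trans (mk≈ x) (mk≈ y) = mk≈ (trans x y)

  +-cong-≈ : ∀ {a b c d} → a ≈ b → c ≈ d → a + c ≈ b + d
  +-cong-≈ {a} {b} {c} {d} (mk≈ x) (mk≈ y) = mk≈ (trans (%-distribˡ-+ a c p)
    (trans (cong₂ (λ m n → (m + n) % p) x y) (sym (%-distribˡ-+ b d p))))

  *-cong-≈ : ∀ {a b c d} → a ≈ b → c ≈ d → a * c ≈ b * d
  *-cong-≈ {a} {b} {c} {d} (mk≈ x) (mk≈ y) = mk≈ (trans (%-distribˡ-* a c p)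
    (trans (cong₂ (λ m n → (m * n) % p) x y) (sym (%-distribˡ-* b d p))))

  +-multiple : ∀ a k → a + k * p ≈ a
  +-multiple a k = mk≈ ([m+kn]%n≡m%n a k p)

  %-≈ : ∀ a → a % p ≈ a
  %-≈ a = mk≈ (m%n%n≡m%n a p)

  -- Instead of subtracting c, one adds `c * q`, which completes c to a multiple of p.
  +-cancelʳ-≈ : ∀ {a b} c → a + c ≈ b + c → a ≈ b
  +-cancelʳ-≈ {a} {b} c eq = ≈-trans (≈-sym (lem a)) (≈-trans (+-cong-≈ eq (≈-refl {c * q})) (lem b))
    where
    ring : ∀ a c q → a + c + c * q ≡ a + c * suc q
    ring = solve-∀
    lem : ∀ a → a + c + c * q ≈ a
    lem a = ≈-trans (≡⇒≈ (ring a c q)) (+-multiple a c)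

  toℕ-mod : ∀ a → toℕ (a mod p) ≡ a % p
  toℕ-mod a = toℕ-fromℕ< (m%n<n a p)

  mod-cong : ∀ {a b} → a ≈ b → a mod p ≡ b mod p
  mod-cong {a} {b} (mk≈ eq) = toℕ-injective (trans (toℕ-mod a) (trans eq (sym (toℕ-mod b))))

  toℕ-mod-≈ : ∀ a → toℕ (a mod p) ≈ a
  toℕ-mod-≈ a = ≈-trans (≡⇒≈ (toℕ-mod a)) (%-≈ a)

  ≈⇒≡ : {a b : G} → toℕ a ≈ toℕ b → a ≡ b
  ≈⇒≡ {a} {b} (mk≈ eq) = toℕ-injective (trans (sym (m<n⇒m%n≡m (toℕ<n a))) (trans eq (m<n⇒m%n≡m (toℕ<n b))))

  ∣⇒≈0 : ∀ {a} → p ∣ a → a ≈ 0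
  ∣⇒≈0 {a} p∣a = mk≈ (n∣m⇒m%n≡0 a p p∣a)

  ≈0⇒∣ : ∀ {a} → a ≈ 0 → p ∣ a
  ≈0⇒∣ {a} (mk≈ eq) = m%n≡0⇒n∣m a p eq

  inverse : Prime p → ∀ a → ¬ p ∣ a → ∃ λ b → b * a ≈ 1
  inverse pp a p∤a = go (Coprimality.coprime-Bézout (Coprimality.sym (Coprimality.prime⇒coprime pp {{≢-nonZero r≢0}} (m%n<n a p))))
    where
    r = a % p
    r≢0 : r ≢ 0
    r≢0 eq = p∤a (m%n≡0⇒n∣m a p eq)
    scale : ∀ b → b * r ≈ b * a
    scale b = *-cong-≈ (≈-refl {b}) (%-≈ a)
    ring : ∀ b r → b * b * r * r + b * r ≡ (b * r) * (1 + b * r)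
    ring = solve-∀
    go : Bézout.Identity 1 r p → ∃ λ b → b * a ≈ 1
    go (Bézout.+- x y eq) = x , ≈-trans (≈-sym (scale x)) (≈-trans (≡⇒≈ (sym eq)) (+-multiple 1 y))
    -- Here `x * r` is -1 modulo p, so its square is 1 and `x * x * r` is an inverse of r.
    go (Bézout.-+ x y eq) = x * x * r , ≈-trans (≈-sym (scale (x * x * r)))
      (+-cancelʳ-≈ (x * r) (≈-trans (≡⇒≈ (ring x r))
        (≈-trans (*-cong-≈ (≈-refl {x * r}) zero-sum) (≈-trans (≡⇒≈ (*-zeroʳ (x * r))) (≈-sym zero-sum)))))
      where
      zero-sum : 1 + x * r ≈ 0
      zero-sum = ∣⇒≈0 (divides y eq)

  *-cancelˡ-≈ : Prime p → ∀ {a b} n → ¬ p ∣ n → n * a ≈ n * b → a ≈ b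
  *-cancelˡ-≈ pp {a} {b} n p∤n eq = ≈-trans (≈-sym (lem a)) (≈-trans (*-cong-≈ (≈-refl {j}) eq) (lem b))
    where
    j = proj₁ (inverse pp n p∤n)
    lem : ∀ a → j * (n * a) ≈ a
    lem a = ≈-trans (≡⇒≈ (sym (*-assoc j n a)))
      (≈-trans (*-cong-≈ (proj₂ (inverse pp n p∤n)) (≈-refl {a})) (≡⇒≈ (*-identityˡ a)))

  toℕ-next-≈ : ∀ (a : G) → ∃ λ e → toℕ (next a) + e * p ≡ suc (toℕ a)
  toℕ-next-≈ a = go (next-cases a)
    where
    go : (toℕ a < q × toℕ (next a) ≡ suc (toℕ a)) ⊎ (toℕ a ≡ q × toℕ (next a) ≡ 0) →
         ∃ λ e → toℕ (next a) + e * p ≡ suc (toℕ a)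
    go (inj₁ (_   , eq)) = 0 , trans (+-identityʳ _) eq
    go (inj₂ (a≡q , eq)) = 1 , trans (cong (_+ 1 * p) eq) (trans (+-identityʳ p) (cong suc (sym a≡q)))

  mod-next : ∀ a → next (a mod p) ≡ suc a mod p
  mod-next a = ≈⇒≡ (≈-trans step (≈-trans (+-cong-≈ (≈-refl {1}) (toℕ-mod-≈ a)) (≈-sym (toℕ-mod-≈ (suc a)))))
    where
    step : toℕ (next (a mod p)) ≈ suc (toℕ (a mod p))
    step = let e , eq = toℕ-next-≈ (a mod p) in ≈-trans (≈-sym (+-multiple _ e)) (≡⇒≈ eq)

  ∑-next : (f : G → ℕ) → ∑ (f ∘ next) ≡ ∑ f
  ∑-next f = begin
    ∑ (f ∘ next)                                   ≡⟨ sum-init-last (f ∘ next) ⟩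
    ∑ (f ∘ next ∘ inject₁) + f (next (fromℕ q))    ≡⟨ cong₂ _+_ (sum-cong-≗ (λ i → cong f (init i))) (cong f (next-≡ (fromℕ q) (toℕ-fromℕ q))) ⟩
    ∑ (f ∘ suc) + f zero                           ≡⟨ +-comm (∑ (f ∘ suc)) (f zero) ⟩
    ∑ f                                            ∎
    where
    open ≡-Reasoning
    init : ∀ i → next (inject₁ i) ≡ suc i
    init i = toℕ-injective (trans (toℕ-next-< (inject₁ i) (subst (_< q) (sym (toℕ-inject₁ i)) (toℕ<n i))) (cong suc (toℕ-inject₁ i)))

  moment : (G → ℕ) → ℕ
  moment W = ∑ (λ i → toℕ i * W i)

  -- Every weight moves up one step, and the wrap-around from q to 0 loses a multiple of p, recorded
  -- by `e`.
  moment-next : ∀ (W W′ : G → ℕ) → (∀ i → W′ (next i) ≡ W i) → moment W′ ≈ moment W + ∑ W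
  moment-next W W′ shift = ≈-trans (≈-sym (+-multiple (moment W′) E)) (≡⇒≈ (begin
    moment W′ + E * p                                    ≡⟨ cong₂ _+_ (sym (∑-next (λ i → toℕ i * W′ i))) (*-comm E p) ⟩
    ∑ (λ i → toℕ (next i) * W′ (next i)) + p * E         ≡⟨ cong₂ _+_ (sum-cong-≗ (λ i → cong (toℕ (next i) *_) (shift i)))
                                                                     (*-distribˡ-sum p (λ i → e i * W i)) ⟩
    ∑ (λ i → toℕ (next i) * W i) + ∑ (λ i → p * (e i * W i)) ≡⟨ sym (∑-distrib-+ (λ i → toℕ (next i) * W i) (λ i → p * (e i * W i))) ⟩
    ∑ (λ i → toℕ (next i) * W i + p * (e i * W i))       ≡⟨ sum-cong-≗ (λ i → trans (ring p (toℕ (next i)) (e i) (W i))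
                                                              (trans (cong (_* W i) (proj₂ (toℕ-next-≈ i))) (+-comm (W i) _))) ⟩
    ∑ (λ i → toℕ i * W i + W i)                          ≡⟨ ∑-distrib-+ (λ i → toℕ i * W i) W ⟩
    moment W + ∑ W                                       ∎))
    where
    open ≡-Reasoning
    e : G → ℕ
    e i = proj₁ (toℕ-next-≈ i)
    E = ∑ (λ i → e i * W i)
    ring : ∀ p n e w → n * w + p * (e * w) ≡ (n + e * p) * w
    ring = solve-∀

  module _ (pp : Prime p) where

    recip : ℕ → ℕ
    recip a with p ∣? a
    ... | yes _   = 0
    ... | no  p∤a = proj₁ (inverse pp a p∤a)

    recip-* : ∀ a → ¬ p ∣ a → recip a * a ≈ 1
    recip-* a p∤a with p ∣? a
    ... | yes p∣a = contradiction p∣a p∤a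
    ... | no  p∤a = proj₂ (inverse pp a p∤a)

    abstract
      -- Junk if p divides the sum of the weights W.
      barycentre : (G → ℕ) → G
      barycentre W = (recip (∑ W) * moment W) mod p

      barycentre-cong : ∀ {W W′ : G → ℕ} → (∀ i → W i ≡ W′ i) → barycentre W ≡ barycentre W′
      barycentre-cong eq = cong₂ (λ a b → (recip a * b) mod p) (sum-cong-≗ eq) (sum-cong-≗ (λ i → cong (toℕ i *_) (eq i)))

      -- The rotation adds the total weight to the moment; the reciprocal of the total turns this
      -- into a single step.
      barycentre-next : ∀ (W W′ : G → ℕ) → (∀ i → W′ (next i) ≡ W i) → ¬ p ∣ ∑ W → barycentre W′ ≡ next (barycentre W)
      barycentre-next W W′ shift p∤ = trans (mod-cong cong₁) (sym (mod-next (recip (∑ W) * moment W)))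
        where
        ∑≡ : ∑ W′ ≡ ∑ W
        ∑≡ = trans (sym (∑-next W′)) (sum-cong-≗ shift)
        cong₁ : recip (∑ W′) * moment W′ ≈ suc (recip (∑ W) * moment W)
        cong₁ = ≈-trans (*-cong-≈ (≡⇒≈ (cong recip ∑≡)) (moment-next W W′ shift))
          (≈-trans (≡⇒≈ (trans (*-distribˡ-+ (recip (∑ W)) (moment W) (∑ W)) (+-comm (recip (∑ W) * moment W) _)))
            (+-cong-≈ (recip-* (∑ W) p∤) (≈-refl {recip (∑ W) * moment W})))

-- Two-element sumsets

module SumsetGrowth (q : ℕ) (pp : Prime (suc q)) where
  open Modular q

  private
    p = suc q
    G = Fin p

  add : G → G → G
  add a r = (toℕ a + toℕ r) mod p

  add-≈ : ∀ a r → toℕ (add a r) ≈ toℕ a + toℕ r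
  add-≈ a r = toℕ-mod-≈ (toℕ a + toℕ r)

  add-injective : ∀ a {r s} → add a r ≡ add a s → r ≡ s
  add-injective a {r} {s} eq = ≈⇒≡ (+-cancelʳ-≈ (toℕ a) (≈-trans (lem r) (≈-trans (≡⇒≈ (cong toℕ eq)) (≈-sym (lem s)))))
    where
    lem : ∀ r → toℕ r + toℕ a ≈ toℕ (add a r)
    lem r = ≈-trans (≡⇒≈ (+-comm (toℕ r) (toℕ a))) (≈-sym (add-≈ a r))

  -- A nonempty R with R + b ⊆ R + a contains the whole coset of the multiples of b - a.
  translate-closed : ∀ {k} (R : Fin (suc k) → G) a b → a ≢ b → (∀ j → ∃ λ i → add a (R i) ≡ add b (R j)) → p ≤ suc k
  translate-closed {k} R a b a≢b closed = ≮⇒≥ λ k<p →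
    let i , j , i<j , eq = pigeonhole k<p (λ i → g (toℕ i)) in collision (toℕ i) (toℕ j) i<j (toℕ<n j) eq
    where
    f : Fin (suc k) → Fin (suc k)
    f j = proj₁ (closed j)

    g : ℕ → Fin (suc k)
    g n = iter f n zero

    A = toℕ a
    B = toℕ b
    r₀ = toℕ (R zero)

    step : ∀ j → A + toℕ (R (f j)) ≈ B + toℕ (R j)
    step j = ≈-trans (≈-sym (add-≈ a (R (f j)))) (≈-trans (≡⇒≈ (cong toℕ (proj₂ (closed j)))) (add-≈ b (R j)))

    -- Each application of `f` adds b - a to the element of R, so n of them lead from `R zero` to
    -- `R zero` plus n (b - a).
    walk : ∀ n → n * A + toℕ (R (g n)) ≈ n * B + r₀
    walk zero    = ≈-refl
    walk (suc n) = ≈-trans (≡⇒≈ (trans (cong (λ x → suc n * A + toℕ (R x)) (iter-suc f n zero)) (ring₁ A n (toℕ (R (f (g n)))))))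
      (≈-trans (+-cong-≈ (≈-refl {n * A}) (step (g n)))
      (≈-trans (≡⇒≈ (ring₂ (n * A) B (toℕ (R (g n)))))
      (≈-trans (+-cong-≈ (≈-refl {B}) (walk n)) (≡⇒≈ (sym (+-assoc B (n * B) r₀))))))
      where
      ring₁ : ∀ a n r → suc n * a + r ≡ n * a + (a + r)
      ring₁ = solve-∀
      ring₂ : ∀ x y z → x + (y + z) ≡ y + (x + z)
      ring₂ = solve-∀

    -- Comparing the walks of lengths i and j gives d a ≡ d b with 0 < d < p, hence a = b.
    collision : ∀ i j → i < j → j < p → g i ≡ g j → ⊥
    collision i j i<j j<p eq = a≢b (≈⇒≡ (*-cancelˡ-≈ pp d p∤d
      (+-cancelʳ-≈ (i * B + r₀)
        (≈-trans (+-cong-≈ (≈-refl {d * A}) (≈-sym (walk i)))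
        (≈-trans (≡⇒≈ (trans (ring d i A (toℕ (R (g i)))) (cong₂ (λ n x → n * A + toℕ (R x)) d+i≡j eq)))
        (≈-trans (walk j) (≡⇒≈ (trans (cong (λ n → n * B + r₀) (sym d+i≡j)) (sym (ring d i B r₀))))))))))
      where
      d = j ∸ i
      d+i≡j : d + i ≡ j
      d+i≡j = m∸n+n≡m (<⇒≤ i<j)
      ring : ∀ d i a r → d * a + (i * a + r) ≡ (d + i) * a + r
      ring = solve-∀
      p∤d : ¬ p ∣ d
      p∤d p∣d = <⇒≱ (≤-<-trans (m∸n≤m j i) j<p) (∣⇒≤ {{>-nonZero (m<n⇒0<n∸m i<j)}} p∣d)

  Selection : ∀ n → (Fin n → G → Set) → ℕ → Set
  Selection n Av r = Σ (Fin n → G) λ a → (∀ i → Av i (a i)) × ∑ (toℕ ∘ a) ≈ r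

  data Pick (Av : G → Set) : Set where
    single : ∀ a → Av a → Pick Av
    double : ∀ a b → a ≢ b → Av a → Av b → Pick Av

  surplus : ∀ {Av} → Pick Av → ℕ
  surplus (single _ _)         = 0
  surplus (double _ _ _ _ _)   = 1

  cons-selection : ∀ {n Av r} a → Av zero a → Selection n (Av ∘ suc) (toℕ r) → Selection (suc n) Av (toℕ (add a r))
  cons-selection {r = r} a a∈ (as , as∈ , eq) =
    (λ { zero → a ; (suc i) → as i }) , (λ { zero → a∈ ; (suc i) → as∈ i }) ,
    ≈-trans (+-cong-≈ (≈-refl {toℕ a}) eq) (≈-sym (add-≈ a r))

  ◂-injective : ∀ {k} x (R : Fin k → G) → (∀ {i j} → R i ≡ R j → i ≡ j) → ¬ (∃ λ i → R i ≡ x) →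
                     ∀ {i j} → (x ◂ R) i ≡ (x ◂ R) j → i ≡ j
  ◂-injective x R inj x∉ {zero}  {zero}  eq = refl
  ◂-injective x R inj x∉ {zero}  {suc j} eq = contradiction (j , sym eq) x∉
  ◂-injective x R inj x∉ {suc i} {zero}  eq = contradiction (i , eq) x∉
  ◂-injective x R inj x∉ {suc i} {suc j} eq = cong suc (inj eq)

  -- Cauchy-Davenport for sets of at most two elements.
  sumset : ∀ n (Av : Fin n → G → Set) (pick : ∀ i → Pick (Av i)) →
           ∃ λ k → Σ (Fin (suc k) → G) λ R → (∀ {i j} → R i ≡ R j → i ≡ j) × (∀ j → Selection n Av (toℕ (R j))) ×
                   (p ≤ suc k ⊎ ∑ (surplus ∘ pick) ≤ k)
  sumset zero Av pick = 0 , (λ _ → zero) , (λ { {zero} {zero} _ → refl }) , (λ _ → (λ ()) , (λ ()) , ≈-refl) , inj₂ z≤n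
  sumset (suc n) Av pick with sumset n (Av ∘ suc) (pick ∘ suc) | pick zero
  ... | k , R , inj , sel , size | single a a∈ =
    k , add a ∘ R , inj ∘ add-injective a , (λ j → cons-selection {Av = Av} a a∈ (sel j)) , size
  -- If some b + R j lies outside a + R, adjoining it gives one more sum. Otherwise b + R ⊆ a + R,
  -- and R is all of ℤ/p by `translate-closed`.
  ... | k , R , inj , sel , size | double a b a≢b a∈ b∈ with any? (λ j → ¬? (any? (λ i → add a (R i) ≟ᶠ add b (R j))))
  ...   | yes (j , new) =
    suc k , (add b (R j) ◂ (add a ∘ R)) , ◂-injective _ _ (inj ∘ add-injective a) new ,
    (λ { zero → cons-selection {Av = Av} b b∈ (sel j) ; (suc i) → cons-selection {Av = Av} a a∈ (sel i) }) , grow size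
    where
    grow : ∀ {s} → p ≤ suc k ⊎ s ≤ k → p ≤ suc (suc k) ⊎ suc s ≤ suc k
    grow (inj₁ p≤) = inj₁ (m≤n⇒m≤1+n p≤)
    grow (inj₂ s≤) = inj₂ (s≤s s≤)
  ...   | no closed = k , add a ∘ R , inj ∘ add-injective a , (λ j → cons-selection {Av = Av} a a∈ (sel j)) ,
    inj₁ (translate-closed R a b a≢b (λ j → decidable-stable (any? (λ i → add a (R i) ≟ᶠ add b (R j))) (λ ¬∃ → closed (j , ¬∃))))

  -- The surplus is large enough for the sums to fill ℤ/p: were 0 missing, adjoining it would give k
  -- + 2 distinct residues although p ≤ k + 1.
  zero-sum-selection : ∀ n (Av : Fin n → G → Set) (pick : ∀ i → Pick (Av i)) → q ≤ ∑ (surplus ∘ pick) → Selection n Av 0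
  zero-sum-selection n Av pick q≤ with sumset n Av pick
  ... | k , R , inj , sel , size with any? (λ j → R j ≟ᶠ zero)
  ...   | yes (j , eq) = subst (λ r → Selection n Av (toℕ r)) eq (sel j)
  ...   | no  0∉R = contradiction (injective⇒≤ {f = zero ◂ R} (◂-injective zero R inj 0∉R)) (<⇒≱ (s≤s (full size)))
    where
    full : p ≤ suc k ⊎ ∑ (surplus ∘ pick) ≤ k → p ≤ suc k
    full (inj₁ p≤) = p≤
    full (inj₂ s≤) = s≤s (≤-trans q≤ s≤)

-- The prime case

ZeroSumEdge : (n m : ℕ) (F : Family m) → Coloring n F → Set
ZeroSumEdge n m F c = Σ (Fin n → Subset m) (λ A → Σ ((i : Fin n) → T (F (A i))) (λ A∈F →
  PairwiseDisjoint A × ZeroSum n (λ i → c (A i) (A∈F i))))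

-- Counting with indicators.

bit : {A : Set} → Dec A → ℕ
bit (yes _) = 1
bit (no  _) = 0

module _ {A : Set} where

  bit≤1 : (a? : Dec A) → bit a? ≤ 1
  bit≤1 (yes _) = ≤-refl
  bit≤1 (no  _) = z≤n

  bit-yes : (a? : Dec A) → A → bit a? ≡ 1
  bit-yes (yes _) a = refl
  bit-yes (no ¬a) a = contradiction a ¬a

  bit-no : (a? : Dec A) → ¬ A → bit a? ≡ 0
  bit-no (yes a) ¬a = contradiction a ¬a
  bit-no (no _)  ¬a = refl

  bit⁻ : (a? : Dec A) → 1 ≤ bit a? → A
  bit⁻ (yes a) _ = a

bit-mono : {A B : Set} (a? : Dec A) (b? : Dec B) → (A → B) → bit a? ≤ bit b?
bit-mono (yes a) b? f = ≤-reflexive (sym (bit-yes b? (f a)))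
bit-mono (no _)  b? f = z≤n

module _ {n} {Q : Fin n → Set} where

  ∑bit≥1 : (Q? : ∀ i → Dec (Q i)) → 1 ≤ ∑ (λ i → bit (Q? i)) → ∃ Q
  ∑bit≥1 Q? 1≤ with any? Q?
  ... | yes ∃Q = ∃Q
  ... | no ¬∃Q = contradiction (≤-trans 1≤ (≤-reflexive (∑≡0 (λ i → bit-no (Q? i) (λ Qi → ¬∃Q (i , Qi)))))) λ ()

∑bit≥2 : ∀ {n} {Q : Fin n → Set} (Q? : ∀ i → Dec (Q i)) → 2 ≤ ∑ (λ i → bit (Q? i)) →
         ∃ λ a → ∃ λ b → a ≢ b × Q a × Q b
∑bit≥2 {suc n} Q? 2≤ with Q? zero
... | yes Q₀ = let b , Qb = ∑bit≥1 (Q? ∘ suc) (≤-pred 2≤) in zero , suc b , (λ ()) , Q₀ , Qb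
... | no  _  = let a , b , a≢b , Qa , Qb = ∑bit≥2 (Q? ∘ suc) 2≤
               in suc a , suc b , a≢b ∘ sucᶠ-injective , Qa , Qb

∣∷∣ : ∀ {m} s (X : Subset m) → ∣ s ∷ X ∣ ≡ (if s then 1 else 0) + ∣ X ∣
∣∷∣ true  X = refl
∣∷∣ false X = refl

-- The blocks of a sign vector.

module _ {n : ℕ} where

  hasLabel : Fin n → Maybe (Fin n) → Bool
  hasLabel i nothing  = false
  hasLabel i (just g) = isYes (i ≟ᶠ g)

  block : ∀ {m} → Vec (Maybe (Fin n)) m → Fin n → Subset m
  block v i = mapV (hasLabel i) v

  ∈-block⁻ : ∀ {m} (v : Vec (Maybe (Fin n)) m) {i j} → j ∈ block v i → lookup v j ≡ just i
  ∈-block⁻ v {i} {j} j∈ = lem (lookup v j) (trans (sym (Vecₚ.lookup-map j (hasLabel i) v)) (Vecₚ.[]=⇒lookup j∈))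
    where
    lem : ∀ y → hasLabel i y ≡ true → y ≡ just i
    lem (just g) eq with i ≟ᶠ g
    ... | yes i≡g = cong just (sym i≡g)

  ∈-block⁺ : ∀ {m} (v : Vec (Maybe (Fin n)) m) {i j} → lookup v j ≡ just i → j ∈ block v i
  ∈-block⁺ v {i} {j} eq = Vecₚ.lookup⇒[]= j (block v i) (trans (Vecₚ.lookup-map j (hasLabel i) v) (trans (cong (hasLabel i) eq) lem))
    where
    lem : hasLabel i (just i) ≡ true
    lem with i ≟ᶠ i
    ... | yes _   = refl
    ... | no i≢i = contradiction refl i≢i

  block-mono : ∀ {m} {v w : Vec (Maybe (Fin n)) m} → v ≼ w → ∀ i → block v i ⊆ block w i
  block-mono {v = v} {w} v≼w i {j} j∈ = ∈-block⁺ w (v≼w j (∈-block⁻ v j∈))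

  block-disjoint : ∀ {m} (v : Vec (Maybe (Fin n)) m) → PairwiseDisjoint (block v)
  block-disjoint v i j i≢j (x , x∈) = let x∈i , x∈j = x∈p∩q⁻ (block v i) (block v j) x∈
    in i≢j (just-injective (trans (sym (∈-block⁻ v x∈i)) (∈-block⁻ v x∈j)))

  size : ∀ {m} → Vec (Maybe (Fin n)) m → ℕ
  size []            = 0
  size (nothing ∷ v) = size v
  size (just _ ∷ v)  = suc (size v)

  drop-≼ : ∀ {m} {x y : Maybe (Fin n)} {v w : Vec (Maybe (Fin n)) m} → (x ∷ v) ≼ (y ∷ w) → v ≼ w
  drop-≼ v≼w i = v≼w (suc i)

  size-mono : ∀ {m} (v w : Vec (Maybe (Fin n)) m) → v ≼ w → size v ≤ size w
  size-mono []            []            _   = z≤n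
  size-mono (nothing ∷ v) (nothing ∷ w) v≼w = size-mono v w (drop-≼ {v = v} {w} v≼w)
  size-mono (nothing ∷ v) (just _ ∷ w)  v≼w = m≤n⇒m≤1+n (size-mono v w (drop-≼ {v = v} {w} v≼w))
  size-mono (just g ∷ v)  (nothing ∷ w) v≼w = contradiction (v≼w zero refl) λ ()
  size-mono (just g ∷ v)  (just h ∷ w)  v≼w = s≤s (size-mono v w (drop-≼ {v = v} {w} v≼w))

  size-mono-≡ : ∀ {m} (v w : Vec (Maybe (Fin n)) m) → v ≼ w → size v ≡ size w → v ≡ w
  size-mono-≡ []            []            _   _  = refl
  size-mono-≡ (nothing ∷ v) (nothing ∷ w) v≼w eq = cong (nothing ∷_) (size-mono-≡ v w (drop-≼ {v = v} {w} v≼w) eq)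
  size-mono-≡ (nothing ∷ v) (just _ ∷ w)  v≼w eq = contradiction (size-mono v w (drop-≼ {v = v} {w} v≼w)) (<⇒≱ (≤-reflexive (sym eq)))
  size-mono-≡ (just g ∷ v)  (nothing ∷ w) v≼w eq = contradiction (v≼w zero refl) λ ()
  size-mono-≡ (just g ∷ v)  (just h ∷ w)  v≼w eq =
    cong₂ _∷_ (sym (v≼w zero refl)) (size-mono-≡ v w (drop-≼ {v = v} {w} v≼w) (suc-injective eq))

∑-hasLabel : ∀ {n} (g : Fin n) → ∑ (λ i → if hasLabel i (just g) then 1 else 0) ≡ 1
∑-hasLabel {suc n} zero = cong suc (∑≡0 {n} {f = λ i → if hasLabel (suc i) (just zero) then 1 else 0} (λ _ → refl))
∑-hasLabel {suc n} (suc g) = trans (sum-cong-≗ lem) (∑-hasLabel g)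
  where
  lem : ∀ i → (if hasLabel (suc i) (just (suc g)) then 1 else 0) ≡ (if hasLabel i (just g) then 1 else 0)
  lem i with i ≟ᶠ g
  ... | yes _ = refl
  ... | no _  = refl

-- Every nonzero entry lies in exactly one block.
∑∣block∣ : ∀ {n m} (v : Vec (Maybe (Fin n)) m) → ∑ (λ i → ∣ block v i ∣) ≡ size v
∑∣block∣ {n} []        = ∑≡0 {n} {λ _ → 0} (λ _ → refl)
∑∣block∣ (nothing ∷ v) = ∑∣block∣ v
∑∣block∣ (just g ∷ v)  = begin
  ∑ (λ i → ∣ hasLabel i (just g) ∷ block v i ∣)          ≡⟨ sum-cong-≗ (λ i → ∣∷∣ (hasLabel i (just g)) (block v i)) ⟩
  ∑ (λ i → (if hasLabel i (just g) then 1 else 0) + ∣ block v i ∣)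
    ≡⟨ ∑-distrib-+ (λ i → if hasLabel i (just g) then 1 else 0) (λ i → ∣ block v i ∣) ⟩
  ∑ (λ i → if hasLabel i (just g) then 1 else 0) + ∑ (λ i → ∣ block v i ∣)
    ≡⟨ cong₂ _+_ (∑-hasLabel g) (∑∣block∣ v) ⟩
  suc (size v)                                           ∎
  where open ≡-Reasoning

next-injective : ∀ {q} {a b : Fin (suc q)} → next a ≡ next b → a ≡ b
next-injective {q} {a} {b} eq = trans (sym (iter-period a)) (trans (cong (iter next q) eq) (iter-period b))

hasLabel-next : ∀ {q} (i : Fin (suc q)) y → hasLabel (next i) (mapM next y) ≡ hasLabel i y
hasLabel-next i nothing  = refl
hasLabel-next i (just g) = lem (next i ≟ᶠ next g) (i ≟ᶠ g)
  where
  lem : (x? : Dec (next i ≡ next g)) (y? : Dec (i ≡ g)) → isYes x? ≡ isYes y?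
  lem (yes _) (yes _) = refl
  lem (no _)  (no _)  = refl
  lem (yes x) (no ¬y) = contradiction (next-injective x) ¬y
  lem (no ¬x) (yes y) = contradiction (cong next y) ¬x

block-next : ∀ {q m} (v : Vec (Maybe (Fin (suc q))) m) i → block (mapV (mapM next) v) (next i) ≡ block v i
block-next v i = trans (sym (Vecₚ.map-∘ _ _ v)) (Vecₚ.map-cong (hasLabel-next i) v)

-- An equivariant choice of a label; it serves as the sign while no block contains a member of the
-- family.
firstLabel : ∀ {G m} → Signed G m → G
firstLabel (here g v) = g
firstLabel (there x)  = firstLabel x

firstLabel-relabel : ∀ {G m} (f : G → G) (x : Signed G m) → firstLabel (relabel f x) ≡ f (firstLabel x)
firstLabel-relabel f (here g v) = refl
firstLabel-relabel f (there x)  = firstLabel-relabel f x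

size≥1 : ∀ {n m} (x : Signed (Fin n) m) → 1 ≤ size (toVec x)
size≥1 (here g v) = s≤s z≤n
size≥1 (there x)  = size≥1 x

-- The argument by contradiction for p = `suc q`. Here `suc (q + q)` is 2p - 1, so that K is m - (2p
-- - 1).
module PrimeCase (q k : ℕ) (pp : Prime (suc q)) (F : Family (suc k)) (cd : cd≥ (suc q) F (2 * suc q ∸ 1))
                 (c : Coloring (suc q) F) (noEdge : ¬ ZeroSumEdge (suc q) (suc k) F c)
                 (K : ℕ) (K≡ : K + suc (q + q) ≡ suc k) where
  open Modular q
  open SumsetGrowth q pp

  p = suc q
  m = suc k
  G = Fin p

  1≤q : 1 ≤ q
  1≤q = ≤-pred (prime⇒≥2 pp)
    where
    prime⇒≥2 : ∀ {n} → Prime n → 2 ≤ n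
    prime⇒≥2 {0} ()
    prime⇒≥2 {1} ()
    prime⇒≥2 {suc (suc n)} _ = s≤s (s≤s z≤n)

  Has : Subset m → G → Set
  Has X a = ∃ λ S → S ⊆ X × Σ (T (F S)) λ t → c S t ≡ a

  abstract
    has? : ∀ X a → Dec (Has X a)
    has? X a = anySubset? (λ S → (S ⊆? X) ×-dec coloured? S)
      where
      coloured? : ∀ S → Dec (Σ (T (F S)) λ t → c S t ≡ a)
      coloured? S with T? (F S)
      ... | no ¬t = no (λ (t , _) → ¬t t)
      ... | yes t = map′ (t ,_) (λ (t′ , eq) → trans (cong (c S) (T-irrelevant t t′)) eq) (c S t ≟ᶠ a)

  has-mono : ∀ {X Y} → X ⊆ Y → ∀ {a} → Has X a → Has Y a
  has-mono X⊆Y (S , S⊆X , t) = S , (λ x∈S → X⊆Y (S⊆X x∈S)) , t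

  -- `total` matters only when a block has exactly one colour, which it then equals.
  colours one two total : Subset m → ℕ
  colours X = ∑ (λ a → bit (has? X a))
  one X     = bit (1 ≤? colours X)
  two X     = bit (2 ≤? colours X)
  total X   = ∑ (λ a → toℕ a * bit (has? X a))

  colours-mono : ∀ {X Y} → X ⊆ Y → colours X ≤ colours Y
  colours-mono X⊆Y = ∑-mono (λ a → bit-mono (has? _ a) (has? _ a) (has-mono X⊆Y))

  one-mono : ∀ {X Y} → X ⊆ Y → one X ≤ one Y
  one-mono X⊆Y = bit-mono (1 ≤? _) (1 ≤? _) (λ 1≤ → ≤-trans 1≤ (colours-mono X⊆Y))

  two-mono : ∀ {X Y} → X ⊆ Y → two X ≤ two Y
  two-mono X⊆Y = bit-mono (2 ≤? _) (2 ≤? _) (λ 2≤ → ≤-trans 2≤ (colours-mono X⊆Y))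

  Labelling = Signed G m

  B : Labelling → G → Subset m
  B x = block (toVec x)

  B-next : ∀ x i → B (relabel next x) (next i) ≡ B x i
  B-next x i = trans (cong (λ v → block v (next i)) (toVec-relabel next x)) (block-next (toVec x) i)

  -- ν₁ and ν₂ count the blocks whose members of F have at least one, respectively two, colours.
  ν₁ ν₂ : Labelling → ℕ
  ν₁ x = ∑ (λ i → one (B x i))
  ν₂ x = ∑ (λ i → two (B x i))

  ∑B-next : ∀ (f : Subset m → ℕ) x → ∑ (λ i → f (B (relabel next x) i)) ≡ ∑ (λ i → f (B x i))
  ∑B-next f x = trans (sym (∑-next (λ i → f (B (relabel next x) i)))) (sum-cong-≗ (λ i → cong f (B-next x i)))

  ν₁≤p : ∀ x → ν₁ x ≤ p
  ν₁≤p x = ≤-trans (∑-mono {g = λ _ → 1} (λ i → bit≤1 (1 ≤? colours (B x i)))) (≤-reflexive (trans (∑-const p 1) (*-identityʳ p)))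

  -- The blocks are disjoint, so members of F taken from different blocks form a hyperedge.
  no-selection : ∀ x → ¬ Selection p (λ i → Has (B x i)) 0
  no-selection x (a , has , ∑≈0) = noEdge
    ( (λ i → proj₁ (has i))
    , (λ i → proj₁ (proj₂ (proj₂ (has i))))
    , (λ i j i≢j (e , e∈) → let e∈i , e∈j = x∈p∩q⁻ (proj₁ (has i)) (proj₁ (has j)) e∈ in
         block-disjoint (toVec x) i j i≢j (e , x∈p∩q⁺ (proj₁ (proj₂ (has i)) e∈i , proj₁ (proj₂ (has j)) e∈j)))
    , subst (p ∣_) (sym (trans (Σ≡∑ p (λ i → toℕ (c (proj₁ (has i)) (proj₁ (proj₂ (proj₂ (has i)))))))
        (sum-cong-≗ (λ i → cong toℕ (proj₂ (proj₂ (proj₂ (has i)))))))) (≈0⇒∣ ∑≈0))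

  all-coloured : ∀ x → p ≤ ν₁ x → ∀ i → 1 ≤ colours (B x i)
  all-coloured x p≤ν₁ i = bit⁻ (1 ≤? colours (B x i)) (≤-reflexive (sym
    (∑-mono-≡ {f = λ i → one (B x i)} {λ _ → 1} (λ i → bit≤1 (1 ≤? colours (B x i)))
      (trans (≤-antisym (ν₁≤p x) p≤ν₁) (sym (trans (∑-const p 1) (*-identityʳ p)))) i)))

  pick : ∀ X → 1 ≤ colours X → Pick (Has X)
  pick X 1≤ with 2 ≤? colours X
  ... | yes 2≤ = let a , b , a≢b , ha , hb = ∑bit≥2 (has? X) 2≤ in double a b a≢b ha hb
  ... | no  _  = let a , ha = ∑bit≥1 (has? X) 1≤ in single a ha

  surplus-pick : ∀ X 1≤ → surplus (pick X 1≤) ≡ two X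
  surplus-pick X 1≤ with 2 ≤? colours X
  ... | yes _ = refl
  ... | no  _ = refl

  -- If q blocks had two colours each, the sumset of the colour sets would be all of ℤ/p and would
  -- contain 0.
  ν₂<q : ∀ x → p ≤ ν₁ x → ν₂ x < q
  ν₂<q x p≤ν₁ = ≰⇒> λ q≤ν₂ → no-selection x (zero-sum-selection p _ (λ i → pick (B x i) (all-coloured x p≤ν₁ i))
    (≤-trans q≤ν₂ (≤-reflexive (sum-cong-≗ (λ i → sym (surplus-pick (B x i) (all-coloured x p≤ν₁ i)))))))

  total-unique : ∀ {X a} → colours X ≡ 1 → Has X a → total X ≡ toℕ a
  total-unique {X} {a} eq ha = ∑-point (λ a → bit (has? X a)) toℕ a eq (bit-yes (has? X a) ha)

  colours≡1 : ∀ x → p ≤ ν₁ x → ν₂ x ≡ 0 → ∀ i → colours (B x i) ≡ 1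
  colours≡1 x p≤ν₁ ν₂≡0 i = ≤-antisym
    (≤-pred (≰⇒> λ 2≤ → contradiction (trans (sym (bit-yes (2 ≤? colours (B x i)) 2≤)) (∑≡0⁻ (two ∘ B x) ν₂≡0 i)) λ ()))
    (all-coloured x p≤ν₁ i)

  -- With one colour per block this is the sum of the colours of a hyperedge. It ensures that the
  -- barycentre with weights `total` is meaningful.
  p∤total : ∀ x → p ≤ ν₁ x → ν₂ x ≡ 0 → ¬ p ∣ ∑ (total ∘ B x)
  p∤total x p≤ν₁ ν₂≡0 p∣ = no-selection x
    ( (λ i → proj₁ (witness i)) , (λ i → proj₂ (witness i))
    , ≈-trans (≡⇒≈ (sum-cong-≗ (λ i → sym (total-unique (colours≡1 x p≤ν₁ ν₂≡0 i) (proj₂ (witness i)))))) (∣⇒≈0 p∣))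
    where
    witness : ∀ i → ∃ (Has (B x i))
    witness i = ∑bit≥1 (has? (B x i)) (all-coloured x p≤ν₁ i)

  -- When no block is coloured, the blocks form an admissible tuple, to which the bound on the
  -- colorability defect applies.
  small : ∀ x → ν₁ x ≡ 0 → size (toVec x) ≤ K
  small x ν₁≡0 = +-cancelʳ-≤ (suc (q + q)) (size (toVec x)) K (begin
    size (toVec x) + suc (q + q)                ≡⟨ cong₂ _+_ (sym (trans (Σ≡∑ p (λ i → ∣ B x i ∣)) (∑∣block∣ (toVec x)))) (ring q) ⟩
    Σ[ p ] (λ i → ∣ B x i ∣) + (2 * p ∸ 1)      ≤⟨ cd (B x) (block-disjoint (toVec x) , free) ⟩
    m                                           ≡⟨ sym K≡ ⟩
    K + suc (q + q)                             ∎)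
    where
    open ≤-Reasoning
    ring : ∀ q → suc (q + q) ≡ q + suc (q + 0)
    ring = solve-∀
    free : ∀ i S → T (F S) → ¬ (S ⊆ B x i)
    free i S t S⊆ = contradiction
      (trans (sym (bit-yes (1 ≤? colours (B x i))
                 (≤-trans (≤-reflexive (sym (bit-yes (has? (B x i) (c S t)) (S , S⊆ , t , refl))))
                          (term≤∑ (λ a → bit (has? (B x i) a)) (c S t)))))
             (∑≡0⁻ (one ∘ B x) ν₁≡0 i))
      λ ()

  -- With n₁ = ν₁ and n₂ = ν₂, the sign is a if no block is coloured, b if some but not all are,
  -- and, if all are, c when each has a single colour and d otherwise.
  signOf : (n₁ n₂ : ℕ) (a b c d : G) → G
  signOf zero     n₂ a b c d = a
  signOf (suc n₁) n₂ a b c d with suc n₁ <? p | n₂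
  ... | yes _ | _     = b
  ... | no  _ | zero  = c
  ... | no  _ | suc _ = d

  -- One case distinction for two uses: f = `next` yields equivariance, and f = `id` yields
  -- constancy on a level.
  signOf-map : ∀ (f : G → G) {a b c d a′ b′ c′ d′ : G} n₁ {n₂ n₂′} → (p ≤ n₁ → n₂′ ≡ n₂) →
               (n₁ ≡ 0 → a′ ≡ f a) → (1 ≤ n₁ → n₁ < p → b′ ≡ f b) →
               (p ≤ n₁ → n₂ ≡ 0 → c′ ≡ f c) → (p ≤ n₁ → 1 ≤ n₂ → d′ ≡ f d) →
               signOf n₁ n₂′ a′ b′ c′ d′ ≡ f (signOf n₁ n₂ a b c d)
  signOf-map f zero     hn ha hb hc hd = ha refl
  signOf-map f (suc n₁) {n₂} {n₂′} hn ha hb hc hd with suc n₁ <? p | n₂ | n₂′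
  ... | yes lt | _     | _     = hb (s≤s z≤n) lt
  ... | no ¬lt | zero  | zero  = hc (≮⇒≥ ¬lt) refl
  ... | no ¬lt | suc _ | suc _ = hd (≮⇒≥ ¬lt) (s≤s z≤n)
  ... | no ¬lt | zero  | suc _ = contradiction (hn (≮⇒≥ ¬lt)) λ ()
  ... | no ¬lt | suc _ | zero  = contradiction (hn (≮⇒≥ ¬lt)) λ ()

  sign : Labelling → G
  sign x = signOf (ν₁ x) (ν₂ x) (firstLabel x)
    (barycentre pp (one ∘ B x)) (barycentre pp (total ∘ B x)) (barycentre pp (two ∘ B x))

  p∤small : ∀ {n} → 1 ≤ n → n < p → ¬ p ∣ n
  p∤small 1≤n n<p p∣n = <⇒≱ n<p (∣⇒≤ {{>-nonZero 1≤n}} p∣n)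

  -- Every barycentre that is used has total weight prime to p: 0 < ν₁ < p in the second case,
  -- `p∤total` in the third, and 0 < ν₂ < q in the fourth.
  sign-equivariant : ∀ x → sign (relabel next x) ≡ next (sign x)
  sign-equivariant x = trans
    (cong₂ (λ n₁ n₂ → signOf n₁ n₂ (firstLabel x′) 
      (barycentre pp (one ∘ B x′)) (barycentre pp (total ∘ B x′)) (barycentre pp (two ∘ B x′)))
      (∑B-next one x) (∑B-next two x))
    (signOf-map next (ν₁ x) {ν₂ x} (λ _ → refl)
      (λ _ → firstLabel-relabel next x)
      (λ 1≤ <p → rotate one (p∤small 1≤ <p))
      (λ p≤ ≡0 → rotate total (p∤total x p≤ ≡0))
      (λ p≤ 1≤ → rotate two (p∤small 1≤ (<-trans (ν₂<q x p≤) (n<1+n q)))))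
    where
    x′ = relabel next x
    rotate : (f : Subset m → ℕ) → ¬ p ∣ ∑ (f ∘ B x) → barycentre pp (f ∘ B x′) ≡ next (barycentre pp (f ∘ B x))
    rotate f = barycentre-next pp (f ∘ B x) (f ∘ B x′) (λ i → cong f (B-next x i))

  -- The levels are the sizes 1, ..., K while ν₁ = 0, then K + ν₁ for 0 < ν₁ < p, and finally K + p
  -- + ν₂ with ν₂ < q. The largest possible value is K + 2q = k.
  baseOf : ℕ → ℕ → ℕ
  baseOf zero    s = s
  baseOf (suc _) s = K

  topOf : ℕ → ℕ → ℕ
  topOf n₁ n₂ with n₁ <? p
  ... | yes _ = 0
  ... | no  _ = n₂

  topOf-< : ∀ {n₁} n₂ → n₁ < p → topOf n₁ n₂ ≡ 0
  topOf-< {n₁} n₂ lt with n₁ <? p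
  ... | yes _  = refl
  ... | no ¬lt = contradiction lt ¬lt

  topOf-≥ : ∀ {n₁} n₂ → p ≤ n₁ → topOf n₁ n₂ ≡ n₂
  topOf-≥ {n₁} n₂ p≤ with n₁ <? p
  ... | yes lt = contradiction p≤ (<⇒≱ lt)
  ... | no _   = refl

  level : Labelling → ℕ
  level x = baseOf (ν₁ x) (size (toVec x)) + (ν₁ x + topOf (ν₁ x) (ν₂ x))

  1≤level : ∀ x → 1 ≤ level x
  1≤level x = lem (ν₁ x)
    where
    lem : ∀ n {t} → 1 ≤ baseOf n (size (toVec x)) + (n + t)
    lem zero    = ≤-trans (size≥1 x) (m≤m+n _ _)
    lem (suc n) = ≤-trans (s≤s z≤n) (m≤n+m _ K)

  level≤k : ∀ x → level x ≤ k
  level≤k x = +-cancelˡ-≤ 1 _ _ (≤-trans (s≤s (+-mono-≤ base≤K mid≤))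
    (≤-reflexive (trans (sym (+-suc K (q + q))) K≡)))
    where
    base≤K : baseOf (ν₁ x) (size (toVec x)) ≤ K
    base≤K = lem (ν₁ x) (small x)
      where
      lem : ∀ n → (n ≡ 0 → size (toVec x) ≤ K) → baseOf n (size (toVec x)) ≤ K
      lem zero    h = h refl
      lem (suc n) h = ≤-refl
    mid≤ : ν₁ x + topOf (ν₁ x) (ν₂ x) ≤ q + q
    mid≤ with ν₁ x <? p
    ... | yes (s≤s ν₁≤q) = ≤-trans (≤-reflexive (+-identityʳ _)) (≤-trans ν₁≤q (m≤m+n q q))
    ... | no ν₁≮p = ≤-trans (≤-reflexive (cong (_+ ν₂ x) (≤-antisym (ν₁≤p x) (≮⇒≥ ν₁≮p))))
                      (≤-trans (≤-reflexive (sym (+-suc q (ν₂ x)))) (+-monoʳ-≤ q (ν₂<q x (≮⇒≥ ν₁≮p))))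

  -- All three summands of the level are monotone. Equal levels therefore force equal summands, and
  -- the monotone counts then agree block by block.
  ascend : ∀ x y → toVec x ≼ toVec y → level x < level y ⊎ sign x ≡ sign y
  ascend x y x≼y = settle (m≤n⇒m<n∨m≡n (+-mono-≤ base≤ (+-mono-≤ ν₁≤ top≤)))
    where
    ν₁≤ : ν₁ x ≤ ν₁ y
    ν₁≤ = ∑-mono (λ i → one-mono (block-mono {v = toVec x} {toVec y} x≼y i))
    ν₂≤ : ν₂ x ≤ ν₂ y
    ν₂≤ = ∑-mono (λ i → two-mono (block-mono {v = toVec x} {toVec y} x≼y i))
    size≤ = size-mono (toVec x) (toVec y) x≼y

    base≤ : baseOf (ν₁ x) (size (toVec x)) ≤ baseOf (ν₁ y) (size (toVec y))
    base≤ = lem (ν₁ x) (ν₁ y) ν₁≤ (small x)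
      where
      lem : ∀ n n′ → n ≤ n′ → (n ≡ 0 → size (toVec x) ≤ K) → baseOf n (size (toVec x)) ≤ baseOf n′ (size (toVec y))
      lem zero    zero     _ h = size≤
      lem zero    (suc n′) _ h = h refl
      lem (suc n) (suc n′) _ h = ≤-refl

    top≤ : topOf (ν₁ x) (ν₂ x) ≤ topOf (ν₁ y) (ν₂ y)
    top≤ = lem (ν₁ x <? p)
      where
      lem : Dec (ν₁ x < p) → topOf (ν₁ x) (ν₂ x) ≤ topOf (ν₁ y) (ν₂ y)
      lem (yes lt) = ≤-trans (≤-reflexive (topOf-< (ν₂ x) lt)) z≤n
      lem (no ¬lt) = ≤-trans (≤-reflexive (topOf-≥ (ν₂ x) (≮⇒≥ ¬lt)))
        (≤-trans ν₂≤ (≤-reflexive (sym (topOf-≥ (ν₂ y) (≤-trans (≮⇒≥ ¬lt) ν₁≤)))))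

    same : level x ≡ level y → sign x ≡ sign y
    same eq = trans
      (signOf-map id (ν₁ x) {ν₂ y} ν₂≡
        (λ ν₁≡0 → cong firstLabel (toVec-injective x y (size-mono-≡ (toVec x) (toVec y) x≼y (size≡ ν₁≡0 base≡))))
        (λ _ _ → barycentre-cong pp one≡)
        (λ p≤ ν₂≡0 → barycentre-cong pp (total≡ p≤ ν₂≡0))
        (λ p≤ _ → barycentre-cong pp (∑-mono-≡ (λ i → two-mono (block-mono {v = toVec x} {toVec y} x≼y i)) (ν₂≡ p≤))))
      (cong (λ n₁ → signOf n₁ (ν₂ y) (firstLabel y)
        (barycentre pp (one ∘ B y)) (barycentre pp (total ∘ B y)) (barycentre pp (two ∘ B y)))
        ν₁≡)
      where
      base≡ = proj₁ (+-mono-≡ base≤ (+-mono-≤ ν₁≤ top≤) eq)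
      rest≡ = proj₂ (+-mono-≡ base≤ (+-mono-≤ ν₁≤ top≤) eq)
      ν₁≡ = proj₁ (+-mono-≡ ν₁≤ top≤ rest≡)
      top≡ = proj₂ (+-mono-≡ ν₁≤ top≤ rest≡)

      ν₂≡ : p ≤ ν₁ x → ν₂ x ≡ ν₂ y
      ν₂≡ p≤ = trans (sym (topOf-≥ (ν₂ x) p≤)) (trans top≡ (topOf-≥ (ν₂ y) (≤-trans p≤ ν₁≤)))

      size≡ : ν₁ x ≡ 0 → baseOf (ν₁ x) (size (toVec x)) ≡ baseOf (ν₁ y) (size (toVec y)) → size (toVec x) ≡ size (toVec y)
      size≡ ν₁x≡0 eq = trans (cong (λ n → baseOf n (size (toVec x))) (sym ν₁x≡0))
        (trans eq (cong (λ n → baseOf n (size (toVec y))) (trans (sym ν₁≡) ν₁x≡0)))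

      one≡ : ∀ i → one (B x i) ≡ one (B y i)
      one≡ = ∑-mono-≡ (λ i → one-mono (block-mono {v = toVec x} {toVec y} x≼y i)) ν₁≡

      -- Both blocks have exactly one colour, and the colour of the smaller block also occurs in the
      -- larger one.
      total≡ : p ≤ ν₁ x → ν₂ y ≡ 0 → ∀ i → total (B x i) ≡ total (B y i)
      total≡ p≤ ν₂y≡0 i = sum-cong-≗ (λ a → cong (toℕ a *_) (∑-mono-≡
        (λ a → bit-mono (has? (B x i) a) (has? (B y i) a) (has-mono (block-mono {v = toVec x} {toVec y} x≼y i)))
        (trans (colours≡1 x p≤ (trans (ν₂≡ p≤) ν₂y≡0) i) (sym (colours≡1 y (≤-trans p≤ ν₁≤) ν₂y≡0 i))) a))

    settle : level x < level y ⊎ level x ≡ level y → level x < level y ⊎ sign x ≡ sign y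
    settle (inj₁ lt) = inj₁ lt
    settle (inj₂ eq) = inj₂ (same eq)

  absurd : ⊥
  absurd = Tucker.tucker q (ℤ.+ p) refl 1≤q k sign sign-equivariant level 1≤level level≤k ascend

-- The induction over composite numbers

-- `respects` is there because a function rebuilt from its first value and the rest agrees with the
-- original only pointwise.
any-function? : ∀ n {X : Set} → (∀ {Q : X → Set} → (∀ x → Dec (Q x)) → Dec (∃ Q)) →
                {P : (Fin n → X) → Set} → (∀ {f g} → (∀ i → f i ≡ g i) → P f → P g) →
                (∀ f → Dec (P f)) → Dec (∃ P)
any-function? zero    any-X? respects P? = map′ (empty ,_) (λ (f , Pf) → respects (λ ()) Pf) (P? empty)
any-function? (suc n) {X} any-X? {P} respects P? = map′
  (λ (x , f , Pxf) → x ◂ f , Pxf)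
  (λ (f , Pf) → f zero , f ∘ suc , respects (λ { zero → refl ; (suc i) → refl }) Pf)
  (any-X? λ x → any-function? n any-X? (λ eq → respects λ { zero → refl ; (suc i) → eq i }) (λ f → P? (x ◂ f)))

module _ {n m : ℕ} (F : Family m) (c : Coloring n F) where

  c-cong : ∀ {X Y} → X ≡ Y → (s : T (F X)) (t : T (F Y)) → c X s ≡ c Y t
  c-cong {X} refl s t = cong (c X) (T-irrelevant s t)

  ZeroSum-cong : ∀ {x y : Fin n → Fin n} → (∀ i → x i ≡ y i) → ZeroSum n x → ZeroSum n y
  ZeroSum-cong {x} {y} eq = subst (n ∣_) (trans (Σ≡∑ n (toℕ ∘ x))
    (trans (sum-cong-≗ (λ i → cong toℕ (eq i))) (sym (Σ≡∑ n (toℕ ∘ y)))))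

  -- Decidability turns the contradiction of the prime case into a hyperedge, and it makes the
  -- family of good sets Boolean.
  zeroSumEdge? : Dec (ZeroSumEdge n m F c)
  zeroSumEdge? = any-function? n anySubset? respects edge?
    where
    IsEdge : (Fin n → Subset m) → Set
    IsEdge A = Σ ((i : Fin n) → T (F (A i))) λ A∈F → PairwiseDisjoint A × ZeroSum n (λ i → c (A i) (A∈F i))

    respects : ∀ {f g} → (∀ i → f i ≡ g i) → IsEdge f → IsEdge g
    respects eq (f∈F , disj , zs) =
      (λ i → subst (T ∘ F) (eq i) (f∈F i)) ,
      (λ i j i≢j → subst Empty (cong₂ _∩_ (eq i) (eq j)) (disj i j i≢j)) ,
      ZeroSum-cong (λ i → c-cong (eq i) _ _) zs

    edge? : ∀ A → Dec (IsEdge A)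
    edge? A with all? (λ i → T? (F (A i)))
    ... | no ¬t = no (λ (t , _) → ¬t t)
    ... | yes t = map′ (t ,_)
      (λ (t′ , disj , zs) → disj , ZeroSum-cong (λ i → c-cong refl (t′ i) (t i)) zs)
      (all? (λ i → all? (λ j → ¬? (i ≟ᶠ j) →-dec ¬? (nonempty? (A i ∩ A j)))) ×-dec (n ∣? Σ[ n ] (λ i → toℕ (c (A i) (t i)))))

ZeroSumTheorem : ℕ → Set
ZeroSumTheorem n = ∀ m (F : Family m) → cd≥ n F (2 * n ∸ 1) → (c : Coloring n F) → ZeroSumEdge n m F c

zeroSum-prime : ∀ {n} → Prime n → ZeroSumTheorem n
zeroSum-prime {zero}  ()
zeroSum-prime {suc q} pp m F cd c = decidable-stable (zeroSumEdge? F c) (absurd m F cd c)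
  where
  absurd : ∀ m (F : Family m) → cd≥ (suc q) F (2 * suc q ∸ 1) → (c : Coloring (suc q) F) → ¬ ¬ ZeroSumEdge (suc q) m F c
  absurd m F cd c noEdge with T? (F ∅)
  -- If ∅ is in F, then p copies of it are pairwise disjoint and their colours sum to p times one
  -- colour.
  ... | yes t = noEdge ((λ _ → ∅) , (λ _ → t) , (λ { i j _ (x , x∈) → ∉⊥ (proj₁ (x∈p∩q⁻ ∅ ∅ x∈)) }) ,
    subst (suc q ∣_) (sym (trans (Σ≡∑ (suc q) (λ _ → toℕ (c ∅ t))) (∑-const (suc q) (toℕ (c ∅ t))))) (m∣m*n (toℕ (c ∅ t))))
  ... | no ∅∉F = main m F cd c noEdge 2p-1≤m
    where
    -- As ∅ is not in F, the tuple of empty sets is admissible.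
    2p-1≤m : suc (q + q) ≤ m
    2p-1≤m = ≤-trans (≤-trans (≤-reflexive (ring q)) (m≤n+m _ (Σ[ suc q ] (λ _ → ∣ ∅ {m} ∣))))
      (cd (λ _ → ∅) ((λ { i j _ (x , x∈) → ∉⊥ (proj₁ (x∈p∩q⁻ ∅ ∅ x∈)) }) ,
        (λ i S t S⊆∅ → ∅∉F (subst (T ∘ F) (⊆-antisym S⊆∅ ⊥⊆) t))))
      where
      ring : ∀ q → suc (q + q) ≡ q + suc (q + 0)
      ring = solve-∀
    main : ∀ m (F : Family m) → cd≥ (suc q) F (2 * suc q ∸ 1) → (c : Coloring (suc q) F) →
           ¬ ZeroSumEdge (suc q) m F c → suc (q + q) ≤ m → ⊥
    main (suc k) F cd c noEdge le = PrimeCase.absurd q k pp F cd c noEdge (suc k ∸ suc (q + q)) (m∸n+n≡m le)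

-- Subsets of N as subsets of a smaller ground set.

embed : ∀ {m} (N : Subset m) → Subset ∣ N ∣ → Subset m
embed []          C       = []
embed (true ∷ N)  (x ∷ C) = x ∷ embed N C
embed (false ∷ N) C       = false ∷ embed N C

restrict : ∀ {m} (N : Subset m) → Subset m → Subset ∣ N ∣
restrict []          S       = []
restrict (true ∷ N)  (x ∷ S) = x ∷ restrict N S
restrict (false ∷ N) (x ∷ S) = restrict N S

embed-⊆ : ∀ {m} (N : Subset m) C → embed N C ⊆ N
embed-⊆ (true ∷ N)  (true ∷ C) here       = here
embed-⊆ (true ∷ N)  (x ∷ C)    (there i∈) = there (embed-⊆ N C i∈)
embed-⊆ (false ∷ N) C          (there i∈) = there (embed-⊆ N C i∈)

embed-restrict : ∀ {m} (N S : Subset m) → S ⊆ N → embed N (restrict N S) ≡ S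
embed-restrict []          []          S⊆N = refl
embed-restrict (true ∷ N)  (x ∷ S)     S⊆N = cong (x ∷_) (embed-restrict N S (drop-∷-⊆ S⊆N))
embed-restrict (false ∷ N) (false ∷ S) S⊆N = cong (false ∷_) (embed-restrict N S (drop-∷-⊆ S⊆N))
embed-restrict (false ∷ N) (true ∷ S)  S⊆N = contradiction (S⊆N here) λ ()

∣embed∣ : ∀ {m} (N : Subset m) C → ∣ embed N C ∣ ≡ ∣ C ∣
∣embed∣ []          []          = refl
∣embed∣ (true ∷ N)  (true ∷ C)  = cong suc (∣embed∣ N C)
∣embed∣ (true ∷ N)  (false ∷ C) = ∣embed∣ N C
∣embed∣ (false ∷ N) C           = ∣embed∣ N C

embed-∩ : ∀ {m} (N : Subset m) C D → embed N (C ∩ D) ≡ embed N C ∩ embed N D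
embed-∩ []          C       D       = refl
embed-∩ (true ∷ N)  (x ∷ C) (y ∷ D) = cong (x ∧ y ∷_) (embed-∩ N C D)
embed-∩ (false ∷ N) C       D       = cong (false ∷_) (embed-∩ N C D)

embed-nonempty⁻ : ∀ {m} (N : Subset m) C → Nonempty (embed N C) → Nonempty C
embed-nonempty⁻ (true ∷ N)  (true ∷ C) (zero , here)      = zero , here
embed-nonempty⁻ (true ∷ N)  (x ∷ C)    (suc i , there i∈) = let j , j∈ = embed-nonempty⁻ N C (i , i∈) in suc j , there j∈
embed-nonempty⁻ (false ∷ N) C          (suc i , there i∈) = embed-nonempty⁻ N C (i , i∈)

embed-disjoint : ∀ {m} (N : Subset m) C D → Empty (C ∩ D) → Empty (embed N C ∩ embed N D)
embed-disjoint N C D disj ne = disj (embed-nonempty⁻ N (C ∩ D) (subst Nonempty (sym (embed-∩ N C D)) ne))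

embed-⊆⁻ : ∀ {m} (N : Subset m) C D → embed N C ⊆ embed N D → C ⊆ D
embed-⊆⁻ (true ∷ N) (x ∷ C) (y ∷ D) C⊆D here with C⊆D here
... | here = here
embed-⊆⁻ (true ∷ N)  (x ∷ C) (y ∷ D) C⊆D (there i∈) = there (embed-⊆⁻ N C D (drop-∷-⊆ C⊆D) i∈)
embed-⊆⁻ (false ∷ N) C       D       C⊆D i∈         = embed-⊆⁻ N C D (drop-∷-⊆ C⊆D) i∈

-- Sums over pairs of indices and sums of residues.

∑-++ : ∀ m {n} (f : Fin (m + n) → ℕ) → ∑ f ≡ ∑ (λ i → f (i ↑ˡ n)) + ∑ (λ i → f (m ↑ʳ i))
∑-++ zero    f = refl
∑-++ (suc m) f = trans (cong (f zero +_) (∑-++ m (f ∘ suc))) (sym (+-assoc (f zero) _ _))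

∑-combine : ∀ b a (f : Fin (b * a) → ℕ) → ∑ f ≡ ∑ {b} (λ j → ∑ {a} (λ i → f (combine j i)))
∑-combine zero    a f = refl
∑-combine (suc b) a f = trans (∑-++ a f) (cong (∑ (λ i → f (i ↑ˡ (b * a))) +_) (∑-combine b a (λ e → f (a ↑ʳ e))))

∑-mod-∣ : ∀ d .{{_ : NonZero d}} {n} (f : Fin n → ℕ) → d ∣ ∑ (λ i → toℕ (f i mod d)) → d ∣ ∑ f
∑-mod-∣ (suc q) f d∣ = ≈0⇒∣ (≈-trans (≈-sym (lem f)) (∣⇒≈0 d∣))
  where
  open Modular q
  lem : ∀ {n} (f : Fin n → ℕ) → ∑ (λ i → toℕ (f i mod suc q)) ≈ ∑ f
  lem {zero}  f = ≈-refl
  lem {suc n} f = +-cong-≈ (toℕ-mod-≈ (f zero)) (lem (f ∘ suc))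

-- Double negation commutes with finite conjunctions; this allows packings to be chosen in all
-- blocks at once.
¬¬-∀ : ∀ n {P : Fin n → Set} → (∀ i → ¬ ¬ P i) → ¬ ¬ (∀ i → P i)
¬¬-∀ zero    ¬¬P ¬∀ = ¬∀ λ ()
¬¬-∀ (suc n) ¬¬P ¬∀ = ¬¬P zero λ P₀ → ¬¬-∀ n (¬¬P ∘ suc) λ P₊ → ¬∀ λ { zero → P₀ ; (suc i) → P₊ i }

-- From moduli a and b to the modulus b a.

module Product (a b : ℕ) .{{_ : NonZero a}} .{{_ : NonZero b}} (zeroSum-a : ZeroSumTheorem a) (zeroSum-b : ZeroSumTheorem b)
               {m : ℕ} (F : Family m) (cd : cd≥ (b * a) F (2 * (b * a) ∸ 1)) (c : Coloring (b * a) F) where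

  Fam : (N : Subset m) → Family ∣ N ∣
  Fam N S = F (embed N S)

  col : (N : Subset m) → Coloring a (Fam N)
  col N S t = toℕ (c (embed N S) t) mod a

  EdgeIn : Subset m → Set
  EdgeIn N = ZeroSumEdge a ∣ N ∣ (Fam N) (col N)

  edgeIn? : ∀ N → Dec (EdgeIn N)
  edgeIn? N = zeroSumEdge? (Fam N) (col N)

  G : Family m
  G N = isYes (edgeIn? N)

  edgeOf : ∀ N → T (G N) → EdgeIn N
  edgeOf N = toWitness

  sumOf : ∀ {N} → EdgeIn N → ℕ
  sumOf {N} (A , A∈F , _) = ∑ (λ i → toℕ (c (embed N (A i)) (A∈F i)))

  a∣sumOf : ∀ {N} (e : EdgeIn N) → a ∣ sumOf e
  a∣sumOf {N} (A , A∈F , _ , zs) = ∑-mod-∣ a (λ i → toℕ (c (embed N (A i)) (A∈F i)))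
    (subst (a ∣_) (Σ≡∑ a (λ i → toℕ (col N (A i) (A∈F i)))) zs)

  -- The division is exact by `a∣sumOf`, so the sum modulo b a is determined by the quotient modulo
  -- b.
  colG : Coloring b G
  colG N t = (sumOf (edgeOf N t) / a) mod b

  glue : (B : Fin b → Subset m) → (∀ j → Fin a → Subset ∣ B j ∣) → Fin (b * a) → Subset m
  glue B C e = let j , i = remQuot {b} a e in embed (B j) (C j i)

  glue-disjoint : ∀ B C → PairwiseDisjoint B → (∀ j → PairwiseDisjoint (C j)) → PairwiseDisjoint (glue B C)
  glue-disjoint B C B-disj C-disj e e′ e≢e′ = go (remQuot {b} a e) (remQuot {b} a e′)
    (λ eq → e≢e′ (trans (sym (combine-remQuot {b} a e)) (trans (cong (λ (j , i) → combine j i) eq) (combine-remQuot {b} a e′))))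
    where
    go : ∀ ji ji′ → ji ≢ ji′ → Empty (embed (B (proj₁ ji)) (C (proj₁ ji) (proj₂ ji)) ∩ embed (B (proj₁ ji′)) (C (proj₁ ji′) (proj₂ ji′)))
    go (j , i) (j′ , i′) ji≢ with j ≟ᶠ j′
    ... | yes refl = embed-disjoint (B j) (C j i) (C j i′) (C-disj j i i′ (λ i≡i′ → ji≢ (cong (j ,_) i≡i′)))
    ... | no j≢j′ = λ (x , x∈) → let x∈j , x∈j′ = x∈p∩q⁻ (embed (B j) (C j i)) (embed (B j′) (C j′ i′)) x∈
      in B-disj j j′ j≢j′ (x , x∈p∩q⁺ (embed-⊆ (B j) (C j i) x∈j , embed-⊆ (B j′) (C j′ i′) x∈j′))

  -- A witness that the restriction of F to N has a-colorability defect below 2a - 1.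
  Packing : Subset m → Set
  Packing N = Σ (Fin a → Subset ∣ N ∣) λ C → Admissible a (Fam N) C × ∣ N ∣ < ∑ (λ i → ∣ C i ∣) + (2 * a ∸ 1)

  -- The contrapositive of the theorem for a, which yields the packing only up to double negation.
  packing : ∀ N → ¬ EdgeIn N → ¬ ¬ Packing N
  packing N noEdge noPacking = noEdge (zeroSum-a ∣ N ∣ (Fam N)
    (λ C adm → ≮⇒≥ λ lt → noPacking (C , adm , subst (λ s → ∣ N ∣ < s + (2 * a ∸ 1)) (Σ≡∑ a (λ i → ∣ C i ∣)) lt)) (col N))

  -- Together the packings form b a sets admissible for F, so the hypothesis bounds their total
  -- size. Each `B j` exceeds the size of its packing by at most 2a - 2; summation over j gives the
  -- claim.
  packings-bound : ∀ B → PairwiseDisjoint B → (∀ j → Packing (B j)) → ∑ (λ j → ∣ B j ∣) + (2 * b ∸ 1) ≤ m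
  packings-bound B B-disj pack = count a b (∑ (λ j → ∣ B j ∣)) total
    (subst (_≤ b * (2 * a ∸ 1) + total) (trans (∑-distrib-+ (λ _ → 1) (λ j → ∣ B j ∣))
        (cong (_+ ∑ (λ j → ∣ B j ∣)) (trans (∑-const b 1) (*-identityʳ b))))
      (≤-trans (∑-mono (λ j → proj₂ (proj₂ (pack j))))
        (≤-reflexive (trans (∑-distrib-+ packed (λ _ → 2 * a ∸ 1)) (trans (cong (total +_) (∑-const b (2 * a ∸ 1))) (+-comm total _))))))
    (subst (λ s → s + (2 * (b * a) ∸ 1) ≤ m) glue-size (cd (glue B C) (glue-disjoint B C B-disj (λ j → proj₁ (proj₁ (proj₂ (pack j)))) , free)))
    where
    C : ∀ j → Fin a → Subset ∣ B j ∣
    C j = proj₁ (pack j)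
    packed : Fin b → ℕ
    packed j = ∑ (λ i → ∣ C j i ∣)
    total = ∑ packed

    -- A member of F inside a glued piece lies in some `B j`, so its restriction is a member of
    -- `Fam (B j)` inside a packing set.
    free : ∀ e S → T (F S) → ¬ (S ⊆ glue B C e)
    free e S t S⊆ = let j , i = remQuot {b} a e in freeⱼ j i S⊆
      where
      freeⱼ : ∀ j i → ¬ (S ⊆ embed (B j) (C j i))
      freeⱼ j i S⊆C = proj₂ (proj₁ (proj₂ (pack j))) i (restrict (B j) S) (subst (T ∘ F) (sym eq) t)
        (embed-⊆⁻ (B j) _ (C j i) (subst (_⊆ embed (B j) (C j i)) (sym eq) S⊆C))
        where
        eq : embed (B j) (restrict (B j) S) ≡ S
        eq = embed-restrict (B j) S (λ x∈S → embed-⊆ (B j) (C j i) (S⊆C x∈S))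

    glue-size : Σ[ b * a ] (λ e → ∣ glue B C e ∣) ≡ total
    glue-size = trans (Σ≡∑ (b * a) (λ e → ∣ glue B C e ∣)) (trans (∑-combine b a (λ e → ∣ glue B C e ∣))
      (sum-cong-≗ (λ j → sum-cong-≗ (λ i → trans (cong (λ (j , i) → ∣ embed (B j) (C j i) ∣) (remQuot-combine j i)) (∣embed∣ (B j) (C j i))))))

    count : ∀ a b .{{_ : NonZero a}} .{{_ : NonZero b}} s t → b + s ≤ b * (2 * a ∸ 1) + t →
            t + (2 * (b * a) ∸ 1) ≤ m → s + (2 * b ∸ 1) ≤ m
    -- In successor form every `2 * _ ∸ 1` computes without truncation; the summand added on both
    -- sides makes the left side of `le₁` appear.
    count (suc a) (suc b) s t le₁ le₂ = +-cancelˡ-≤ (suc (suc b)) _ _ (begin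
      suc (suc b) + (s + (b + suc (b + 0)))                       ≡⟨ ring₁ b s ⟩
      suc b + s + (suc b + suc b)                                 ≤⟨ +-monoˡ-≤ _ le₁ ⟩
      suc b * (a + suc (a + 0)) + t + (suc b + suc b)             ≡⟨ ring₂ a b t ⟩
      suc (suc b) + (t + (a + b * suc a + suc (a + b * suc a + 0))) ≤⟨ +-monoʳ-≤ (suc (suc b)) le₂ ⟩
      suc (suc b) + m                                             ∎)
      where
      open ≤-Reasoning
      ring₁ : ∀ b s → suc (suc b) + (s + (b + suc (b + 0))) ≡ suc b + s + (suc b + suc b)
      ring₁ = solve-∀
      ring₂ : ∀ a b t → suc b * (a + suc (a + 0)) + t + (suc b + suc b) ≡
                        suc (suc b) + (t + (a + b * suc a + suc (a + b * suc a + 0)))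
      ring₂ = solve-∀

  cdG : cd≥ b G (2 * b ∸ 1)
  cdG B (disj , free) = subst (λ s → s + (2 * b ∸ 1) ≤ m) (sym (Σ≡∑ b (λ j → ∣ B j ∣)))
    (decidable-stable (_ ≤? m) λ ¬le →
      -- Since `B j` contains itself, admissibility says that it is not good, and so it has a
      -- packing.
      ¬¬-∀ b (λ j → packing (B j) (λ e → free j (B j) (fromWitness e) ⊆-refl)) λ pack → ¬le (packings-bound B disj pack))

  edge : ZeroSumEdge (b * a) m F c
  edge with zeroSum-b m G cdG colG
  ... | N , N∈G , N-disj , zs = A , A∈F , glue-disjoint N C N-disj (λ j → proj₁ (proj₂ (proj₂ (edges j)))) , zero-sum
    where
    edges : ∀ j → EdgeIn (N j)
    edges j = edgeOf (N j) (N∈G j)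
    C : ∀ j → Fin a → Subset ∣ N j ∣
    C j = proj₁ (edges j)
    A = glue N C
    A∈F : ∀ e → T (F (A e))
    A∈F e = let j , i = remQuot {b} a e in proj₁ (proj₂ (edges j)) i

    quot : Fin b → ℕ
    quot j = sumOf (edges j) / a

    -- The sum of all colours is a times the sum of the quotients, and b divides the latter.
    zero-sum : b * a ∣ Σ[ b * a ] (λ e → toℕ (c (A e) (A∈F e)))
    zero-sum = subst (b * a ∣_) (sym total) (subst (_∣ a * ∑ quot) (*-comm a b)
      (*-monoʳ-∣ a (∑-mod-∣ b quot (subst (b ∣_) (Σ≡∑ b (λ j → toℕ (quot j mod b))) zs))))
      where
      total : Σ[ b * a ] (λ e → toℕ (c (A e) (A∈F e))) ≡ a * ∑ quot
      total = trans (Σ≡∑ (b * a) (λ e → toℕ (c (A e) (A∈F e))))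
        (trans (∑-combine b a (λ e → toℕ (c (A e) (A∈F e))))
        (trans (sum-cong-≗ (λ j → trans
          (sum-cong-≗ (λ i → cong (λ (j , i) → toℕ (c (embed (N j) (C j i)) (proj₁ (proj₂ (edges j)) i))) (remQuot-combine j i)))
          (sym (m*[n/m]≡n (a∣sumOf (edges j))))))
        (sym (*-distribˡ-sum a quot))))

-- Strong induction on n.

zeroSum : ∀ n → 2 ≤ n → ZeroSumTheorem n
zeroSum = <-rec (λ n → 2 ≤ n → ZeroSumTheorem n) step
  where
  composite : ∀ n → (∀ {k} → k < n → 2 ≤ k → ZeroSumTheorem k) → 2 ≤ n → ∀ d → 1 < d → d < n → d ∣ n → ZeroSumTheorem n
  composite .(b * d) rec 2≤n d 1<d d<n (divides b refl) m F cd c =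
    Product.edge d b {{>-nonZero (<-trans z<s 1<d)}} {{>-nonZero (<-trans z<s 1<b)}} (rec d<n 1<d) (rec b<n 1<b) F cd c
    where
    1<b : 1 < b
    1<b = ≰⇒> λ b≤1 → <⇒≱ d<n (≤-trans (*-monoˡ-≤ d b≤1) (≤-reflexive (*-identityˡ d)))
    b<n : b < b * d
    b<n = m<m*n b d {{>-nonZero (<-trans z<s 1<b)}} 1<d

  step : ∀ n → (∀ {k} → k < n → 2 ≤ k → ZeroSumTheorem k) → 2 ≤ n → ZeroSumTheorem n
  step n rec 2≤n with prime? n
  ... | yes pp = zeroSum-prime pp
  ... | no ¬pp with ¬prime⇒composite {{n>1⇒nonTrivial 2≤n}} ¬pp
  ...   | hasNonTrivialDivisor {d} d<n d∣n = composite n rec 2≤n d (nonTrivial⇒n>1 d) d<n d∣n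

theorem1p3 : (n m : ℕ) → 2 ≤ n → (F : Family m) → cd≥ n F (2 * n ∸ 1) →
    (c : Coloring n F) →
    Σ (Fin n → Subset m) (λ A → Σ ((i : Fin n) → T (F (A i))) (λ A∈F →
    PairwiseDisjoint A × ZeroSum n (λ i → c (A i) (A∈F i))))
theorem1p3 n m 2≤n F cd c = zeroSum n 2≤n m F cd c
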